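{- Let $p\ge 5$ be a prime and let $r$ be an integer with $1\le r\le p-1$ such that either $3r+1$ is a quadratic non-residue modulo $p$ or $3r+1\equiv 0\pmod p$. Then for all integers $n\ge 0$ and all integers $k\ge j\ge 0$, \[ a_{p(k-j)+(p-3),\;pk+(p+2)}(pn+r)\equiv 0 \pmod p. \]
   Context: For positive integers $r,s$, $a_{r,s}(n)$ denotes the number of multicolored partitions of $n$ in which each even part may appear in one of $r$ colors and each odd part may appear in one of $s$ colors (copies of the same part size in different colors are distinct), with $a_{r,s}(0)=1$. Equivalently, for $|q|<1$, $\sum_{n\ge0}a_{r,s}(n)q^n = f_2^{s-r}/f_1^{s}$, where $f_m=\prod_{i\ge1}(1-q^{mi})$. -}

module Defs where

open import Data.Nat using (ℕ; zero; suc; _+_; _*_; _∸_; _≤ᵇ_; _≡ᵇ_)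
open import Data.Bool using (Bool; true; false; if_then_else_)
open import Data.List using (List; []; _∷_; map; upTo; concatMap; replicate)
open import Data.Nat.ListAction using (sum)
open import Data.Product using (_×_)
open import Relation.Nullary using (¬_)
open import Data.Nat.Divisibility using (_∣_)
open import Data.Integer using (ℤ; +_; _-_)
import Data.Integer.Divisibility as ℤD

isEven : ℕ → Bool
isEven zero = true
isEven (suc zero) = false
isEven (suc (suc m)) = isEven m

colours : ℕ → ℕ → ℕ → ℕ
colours r s m = if isEven m then r else s

-- The list of all coloured parts of size 1..N: the part size m is listed
-- once per colour, so each entry stands for one distinct coloured part.
colouredParts : ℕ → ℕ → ℕ → List ℕ
colouredParts r s N = concatMap (λ m → replicate (colours r s m) m) (map suc (upTo N))

-- ways n cs = number of multisets of elements of cs (each entry of cs being a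
-- distinct coloured part, whose value is its part size) with total size n;
-- i.e. choose a multiplicity t for each coloured part.
ways : ℕ → List ℕ → ℕ
ways n [] = if n ≡ᵇ 0 then 1 else 0
ways n (v ∷ vs) =
  sum (map (λ t → if t * v ≤ᵇ n then ways (n ∸ t * v) vs else 0) (upTo (suc n)))

-- a_{r,s}(n): number of multicoloured partitions of n with even parts in r
-- colours and odd parts in s colours (only parts of size ≤ n can occur).
a : ℕ → ℕ → ℕ → ℕ
a r s n = ways n (colouredParts r s n)

QNR : ℕ → ℕ → Set
QNR x p = ¬ (p ∣ x) × (∀ y → ¬ ((+ p) ℤD.∣ ((+ (y * y)) - (+ x))))

{-# OPTIONS --safe #-}
{-
Write f_m = ∏ (1 - q^(mi)). The generating function f_2^(pj+5) / f_1^(p(k+1)+2) is congruent mod p to a power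
series in q^p times f_2^5 / f_1^2, and
  f_2^5 / f_1^2 = Σ_{w ∈ ℤ} (-1)^w (3w+1) q^(3w²+2w).
If e = 3w²+2w is ≡ r mod p, then 3r+1 ≡ 3e+1 = (3w+1)², which is excluded when 3r+1 is a non-residue and forces
p ∣ 3w+1 when p ∣ 3r+1.

The theta identity follows from f_1 = Σ (-1)^l q^(l(3l+1)/2) (Euler, via Shanks' finite identity),
f_2^3 = ½ Σ (-1)^n (2n+1) q^(n²+n) (Jacobi) and f_2^2 / f_1 = ½ Σ q^(m(m+1)/2) (Gauss), the last two being the cases
d = -2 and d = 2 of a finite triple product: the weight 2n+1 in the product of the last two series may be replaced by
2(n+m+1) =: 2t. Summing over the residues of t mod 3, the class 0 cancels by a reflection and the classes ±1 each give
the theta series times Σ (-1)^l q^(l(3l+1)/2), after the substitution n = w + l, t = 3w + 1.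

Infinite series are replaced by a commutative ring in which q^N = 0, here ℤ/p[[X]] modulo X^N as a setoid.
-}
module Submission where

open import Algebra.Bundles using (CommutativeRing)
open import Algebra.Solver.Ring.AlmostCommutativeRing using (fromCommutativeRing; _-Raw-AlmostCommutative⟶_)
open import Data.Bool.Base using (true; false; if_then_else_)
open import Data.Empty using (⊥-elim)
open import Data.Integer.Base as ℤ using (ℤ; +_; -[1+_]; ∣_∣; _⊖_)
import Data.Integer.Divisibility.Signed as ℤS
import Data.Integer.Properties as ℤₚ
open import Data.Integer.Tactic.RingSolver using () renaming (solve-∀ to solveℤ-∀)
open import Data.List.Base using (List; []; _∷_; map; applyUpTo; concatMap; replicate; _++_)
open import Data.Maybe.Base using (Maybe; just; nothing)
open import Data.Nat.Base as ℕ using (ℕ; zero; suc; z≤n; s≤s; _≤ᵇ_; _∸_; NonZero)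
open import Data.Nat.Combinatorics using (_C_; nCk+nC[k+1]≡[n+1]C[k+1]; k>n⇒nCk≡0; nCn≡1; nC1≡n)
open import Data.Nat.DivMod using (_%_; _/_; [m+kn]%n≡m%n; m≡m%n+[m/n]*n; m%n<n; m<n⇒m%n≡m)
open import Data.Nat.Divisibility using (_∣_; divides; ∣⇒≤)
open import Data.Nat.ListAction using (sum)
open import Data.Nat.Primality using (Prime; euclidsLemma; prime⇒nonZero; prime⇒irreducible)
import Data.Nat.Properties as ℕₚ
open import Data.Nat.Tactic.RingSolver using (solve-∀)
open import Data.Product using (∃; _,_)
open import Data.Sum using (_⊎_; inj₁; inj₂)
open import Data.Unit using (tt)
open import Level using (0ℓ)
open import Relation.Binary.PropositionalEquality as ≡ using (_≡_; _≢_)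
open import Relation.Nullary using (¬_; yes; no)

-- Modulo p one has (1 - x)^p = 1 - x^p, so f_1^p and f_2^p become products of factors 1 - q^(mp).
-- Multiplying by such a factor, or cancelling one, respects the vanishing of all coefficients at
-- exponents ≡ r mod p; hence f_1^(p(k+1)) is cancelled and never has to be inverted as a series in
-- q^p.
--
-- Residues mod 3 enter by completing the square: for fixed t, twice the exponent n² + n + m(m+1)/2
-- is 3n² + 3n - 2tn + t² - t, a parabola in n with axis t/3 - 1/2. For t = 3w the axis is w - 1/2;
-- reflection in it changes the parity of n, so the sum cancels. For t = 3w + 1 it is w - 1/6, and l
-- = n - w has the axis of the pentagonal numbers. The case t = 3w + 2 is the previous one with t
-- negated.
--
-- Working modulo q^N replaces convergence by bookkeeping: sums over ℤ run over finite windows, and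
-- a change of variables first widens the window by terms that are 0. Sums over ℤ double the
-- one-sided ones, so 4 must be invertible, which holds because p is odd.

module Exponents where

  -- Exponents as quadratic forms on ℤ.

  tri : ℕ → ℕ
  tri zero    = zero
  tri (suc n) = suc n ℕ.+ tri n

  n≤tri : ∀ n → n ℕ.≤ tri n
  n≤tri zero    = z≤n
  n≤tri (suc n) = ℕₚ.m≤m+n (suc n) (tri n)

  triℤ : ℤ → ℕ
  triℤ (+ n)    = tri n
  triℤ -[1+ n ] = tri n

  sqℤ : ℤ → ℕ
  sqℤ k = ∣ k ∣ ℕ.* ∣ k ∣

  -- The 1 is forced by k = -1, where the triangular number is 0; it is why the windows used later
  -- have half-width N + 1.
  ∣k∣≤1+triℤ : ∀ k → ∣ k ∣ ℕ.≤ suc (triℤ k)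
  ∣k∣≤1+triℤ (+ n)    = ℕₚ.m≤n⇒m≤1+n (n≤tri n)
  ∣k∣≤1+triℤ -[1+ n ] = s≤s (n≤tri n)

  sqℤ≡ : ∀ k → + sqℤ k ≡ k ℤ.* k
  sqℤ≡ (+ n)    = ℤₚ.pos-* n n
  sqℤ≡ -[1+ n ] = ≡.refl

  private
    2tri≡ : ∀ n → + 2 ℤ.* + tri n ≡ + n ℤ.* (+ n ℤ.+ + 1)
    2tri≡ zero    = ≡.refl
    2tri≡ (suc n) = ≡.trans (≡.trans (dist (+ n) (+ tri n)) (≡.cong (ℤ._+_ (+ 2 ℤ.* (+ 1 ℤ.+ + n))) (2tri≡ n))) (collect (+ n))
      where
      dist : ∀ n t → + 2 ℤ.* ((+ 1 ℤ.+ n) ℤ.+ t) ≡ + 2 ℤ.* (+ 1 ℤ.+ n) ℤ.+ + 2 ℤ.* t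
      dist = solveℤ-∀
      collect : ∀ n → + 2 ℤ.* (+ 1 ℤ.+ n) ℤ.+ n ℤ.* (n ℤ.+ + 1) ≡ (+ 1 ℤ.+ n) ℤ.* ((+ 1 ℤ.+ n) ℤ.+ + 1)
      collect = solveℤ-∀

  2triℤ≡ : ∀ k → + 2 ℤ.* + triℤ k ≡ k ℤ.* (k ℤ.+ + 1)
  2triℤ≡ (+ n)    = 2tri≡ n
  2triℤ≡ -[1+ n ] = ≡.trans (2tri≡ n) (flip (+ n))
    where
    flip : ∀ n → n ℤ.* (n ℤ.+ + 1) ≡ ℤ.- (+ 1 ℤ.+ n) ℤ.* (ℤ.- (+ 1 ℤ.+ n) ℤ.+ + 1)
    flip = solveℤ-∀

  private
    -- Triangular numbers are not integer polynomials, so exponents are compared after doubling,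
    -- where the ring solver applies.
    halve : ∀ {m n} → + 2 ℤ.* + m ≡ + 2 ℤ.* + n → m ≡ n
    halve eq = ℤₚ.+-injective (ℤₚ.*-cancelˡ-≡ (+ 2) _ _ eq)

  -- 3w² + 2w, and next l(3l+1)/2, written as sums of natural numbers so that negative arguments
  -- still give exponents.
  thetaExp : ℤ → ℕ
  thetaExp w = sqℤ w ℕ.+ 4 ℕ.* triℤ w

  pentExp : ℤ → ℕ
  pentExp l = sqℤ l ℕ.+ triℤ l

  -- The exponent n² + n + m(m+1)/2 in the coordinates n and t = n + m + 1.
  latticeExp : ℤ → ℤ → ℕ
  latticeExp n t = 2 ℕ.* triℤ n ℕ.+ triℤ (t ℤ.- n ℤ.- + 1)

  private
    latticeForm : ℤ → ℤ → ℤ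
    latticeForm n t = + 2 ℤ.* (n ℤ.* (n ℤ.+ + 1)) ℤ.+ (t ℤ.- n ℤ.- + 1) ℤ.* (t ℤ.- n ℤ.- + 1 ℤ.+ + 1)

    double-latticeExp : ∀ n t → + 2 ℤ.* + latticeExp n t ≡ latticeForm n t
    double-latticeExp n t = ≡.trans (≡.cong (λ x → + 2 ℤ.* (x ℤ.+ + triℤ m)) (ℤₚ.pos-* 2 (triℤ n)))
      (≡.trans (dist (+ triℤ n) (+ triℤ m)) (≡.cong₂ (λ x y → + 2 ℤ.* x ℤ.+ y) (2triℤ≡ n) (2triℤ≡ m)))
      where
      m = t ℤ.- n ℤ.- + 1
      dist : ∀ s t → + 2 ℤ.* (+ 2 ℤ.* s ℤ.+ t) ≡ + 2 ℤ.* (+ 2 ℤ.* s) ℤ.+ + 2 ℤ.* t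
      dist = solveℤ-∀

  thetaExp≡ : ∀ w → + thetaExp w ≡ + 3 ℤ.* (w ℤ.* w) ℤ.+ + 2 ℤ.* w
  thetaExp≡ w = ≡.trans (≡.cong₂ ℤ._+_ (sqℤ≡ w) (ℤₚ.pos-* 4 (triℤ w)))
    (≡.trans (dist w (+ triℤ w)) (≡.trans (≡.cong (λ x → w ℤ.* w ℤ.+ + 2 ℤ.* x) (2triℤ≡ w)) (collect w)))
    where
    dist : ∀ w t → w ℤ.* w ℤ.+ + 4 ℤ.* t ≡ w ℤ.* w ℤ.+ + 2 ℤ.* (+ 2 ℤ.* t)
    dist = solveℤ-∀
    collect : ∀ w → w ℤ.* w ℤ.+ + 2 ℤ.* (w ℤ.* (w ℤ.+ + 1)) ≡ + 3 ℤ.* (w ℤ.* w) ℤ.+ + 2 ℤ.* w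
    collect = solveℤ-∀

  double-pentExp : ∀ l → + 2 ℤ.* + pentExp l ≡ + 3 ℤ.* (l ℤ.* l) ℤ.+ l
  double-pentExp l = ≡.trans (dist (+ sqℤ l) (+ triℤ l))
    (≡.trans (≡.cong₂ (λ x y → + 2 ℤ.* x ℤ.+ y) (sqℤ≡ l) (2triℤ≡ l)) (collect l))
    where
    dist : ∀ s t → + 2 ℤ.* (s ℤ.+ t) ≡ + 2 ℤ.* s ℤ.+ + 2 ℤ.* t
    dist = solveℤ-∀
    collect : ∀ l → + 2 ℤ.* (l ℤ.* l) ℤ.+ l ℤ.* (l ℤ.+ + 1) ≡ + 3 ℤ.* (l ℤ.* l) ℤ.+ l
    collect = solveℤ-∀

  -- The reflection k ↦ -1-k fixing the triangular numbers, defined by cases so that it computes on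
  -- both constructors.
  ρ : ℤ → ℤ
  ρ (+ n)    = -[1+ n ]
  ρ -[1+ n ] = + n

  ρ≡ : ∀ k → ρ k ≡ ℤ.- (+ 1 ℤ.+ k)
  ρ≡ (+ n)    = ≡.refl
  ρ≡ -[1+ n ] = ≡.sym (flip (+ n))
    where
    flip : ∀ n → ℤ.- (+ 1 ℤ.+ ℤ.- (+ 1 ℤ.+ n)) ≡ n
    flip = solveℤ-∀

  -- At t = 3w + 1 the axis of the parabola in n is w - 1/6, so no cross term between w and l = n -
  -- w survives.
  latticeExp-split : ∀ w l → latticeExp (l ℤ.+ w) (w ℤ.* + 3 ℤ.+ + 1) ≡ thetaExp w ℕ.+ pentExp l
  latticeExp-split w l = halve (≡.trans (double-latticeExp (l ℤ.+ w) (w ℤ.* + 3 ℤ.+ + 1)) (≡.trans (poly w l) (≡.sym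
    (≡.trans (dist (+ thetaExp w) (+ pentExp l)) (≡.cong₂ (λ x y → + 2 ℤ.* x ℤ.+ y) (thetaExp≡ w) (double-pentExp l))))))
    where
    dist : ∀ s t → + 2 ℤ.* (s ℤ.+ t) ≡ + 2 ℤ.* s ℤ.+ + 2 ℤ.* t
    dist = solveℤ-∀
    poly : ∀ w l → + 2 ℤ.* ((l ℤ.+ w) ℤ.* (l ℤ.+ w ℤ.+ + 1))
        ℤ.+ (w ℤ.* + 3 ℤ.+ + 1 ℤ.- (l ℤ.+ w) ℤ.- + 1) ℤ.* (w ℤ.* + 3 ℤ.+ + 1 ℤ.- (l ℤ.+ w) ℤ.- + 1 ℤ.+ + 1)
      ≡ + 2 ℤ.* (+ 3 ℤ.* (w ℤ.* w) ℤ.+ + 2 ℤ.* w) ℤ.+ (+ 3 ℤ.* (l ℤ.* l) ℤ.+ l)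
    poly = solveℤ-∀

  -- At t = 3w the axis in l = n - w is -1/2, the fixed point of `ρ`.
  latticeExp-ρ₀ : ∀ w l → latticeExp (ρ l ℤ.+ w) (w ℤ.* + 3) ≡ latticeExp (l ℤ.+ w) (w ℤ.* + 3)
  latticeExp-ρ₀ w l = halve (≡.trans (double-latticeExp (ρ l ℤ.+ w) (w ℤ.* + 3))
    (≡.trans (≡.cong (λ k → latticeForm (k ℤ.+ w) (w ℤ.* + 3)) (ρ≡ l))
      (≡.trans (poly w l) (≡.sym (double-latticeExp (l ℤ.+ w) (w ℤ.* + 3))))))
    where
    poly : ∀ w l → + 2 ℤ.* ((ℤ.- (+ 1 ℤ.+ l) ℤ.+ w) ℤ.* (ℤ.- (+ 1 ℤ.+ l) ℤ.+ w ℤ.+ + 1))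
        ℤ.+ (w ℤ.* + 3 ℤ.- (ℤ.- (+ 1 ℤ.+ l) ℤ.+ w) ℤ.- + 1) ℤ.* (w ℤ.* + 3 ℤ.- (ℤ.- (+ 1 ℤ.+ l) ℤ.+ w) ℤ.- + 1 ℤ.+ + 1)
      ≡ + 2 ℤ.* ((l ℤ.+ w) ℤ.* (l ℤ.+ w ℤ.+ + 1))
        ℤ.+ (w ℤ.* + 3 ℤ.- (l ℤ.+ w) ℤ.- + 1) ℤ.* (w ℤ.* + 3 ℤ.- (l ℤ.+ w) ℤ.- + 1 ℤ.+ + 1)
    poly = solveℤ-∀

  -- Negating t while reflecting n also reflects m = t - n - 1, and both triangular numbers are
  -- invariant.
  latticeExp-ρ : ∀ n t → latticeExp (ρ n) (ℤ.- t) ≡ latticeExp n t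
  latticeExp-ρ n t = halve (≡.trans (double-latticeExp (ρ n) (ℤ.- t))
    (≡.trans (≡.cong (λ k → latticeForm k (ℤ.- t)) (ρ≡ n)) (≡.trans (poly n t) (≡.sym (double-latticeExp n t)))))
    where
    poly : ∀ n t → + 2 ℤ.* (ℤ.- (+ 1 ℤ.+ n) ℤ.* (ℤ.- (+ 1 ℤ.+ n) ℤ.+ + 1))
        ℤ.+ (ℤ.- t ℤ.- ℤ.- (+ 1 ℤ.+ n) ℤ.- + 1) ℤ.* (ℤ.- t ℤ.- ℤ.- (+ 1 ℤ.+ n) ℤ.- + 1 ℤ.+ + 1)
      ≡ + 2 ℤ.* (n ℤ.* (n ℤ.+ + 1)) ℤ.+ (t ℤ.- n ℤ.- + 1) ℤ.* (t ℤ.- n ℤ.- + 1 ℤ.+ + 1)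
    poly = solveℤ-∀

  -- Two uses of |n + 1| ≤ M: |m| ≥ |t| - |n + 1| ≥ 3M - 2|n + 1| ≥ M for m = t - n - 1. This fixes
  -- the factor 3 in the widened window.
  window-bound : ∀ M n t → ∣ n ℤ.+ + 1 ∣ ℕ.≤ M → M ℕ.* 3 ℕ.≤ ∣ t ∣ ℕ.+ ∣ n ℤ.+ + 1 ∣ → M ℕ.≤ ∣ t ℤ.- n ℤ.- + 1 ∣
  window-bound M n t n+1≤M 3M≤ = ℕₚ.+-cancelʳ-≤ (M ℕ.+ M) M d (begin
    M ℕ.+ (M ℕ.+ M)                        ≡⟨ triple M ⟩
    M ℕ.* 3                                ≤⟨ 3M≤ ⟩
    ∣ t ∣ ℕ.+ ∣ n ℤ.+ + 1 ∣                ≤⟨ ℕₚ.+-mono-≤ triangle n+1≤M ⟩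
    (d ℕ.+ ∣ n ℤ.+ + 1 ∣) ℕ.+ M            ≤⟨ ℕₚ.+-monoˡ-≤ M (ℕₚ.+-monoʳ-≤ d n+1≤M) ⟩
    (d ℕ.+ M) ℕ.+ M                        ≡⟨ ℕₚ.+-assoc d M M ⟩
    d ℕ.+ (M ℕ.+ M)                        ∎)
    where
    open ℕₚ.≤-Reasoning
    d = ∣ t ℤ.- n ℤ.- + 1 ∣
    triple : ∀ M → M ℕ.+ (M ℕ.+ M) ≡ M ℕ.* 3
    triple = solve-∀
    split : ∀ t n → (t ℤ.- n ℤ.- + 1) ℤ.+ (n ℤ.+ + 1) ≡ t
    split = solveℤ-∀
    triangle : ∣ t ∣ ℕ.≤ d ℕ.+ ∣ n ℤ.+ + 1 ∣
    triangle = ≡.subst (λ k → ∣ k ∣ ℕ.≤ d ℕ.+ ∣ n ℤ.+ + 1 ∣) (split t n) (ℤₚ.∣i+j∣≤∣i∣+∣j∣ (t ℤ.- n ℤ.- + 1) (n ℤ.+ + 1))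

-- Recurrences for the number of multisets of parts.

module Ways where

  open import Data.Bool.Base using (T)
  open import Defs using (ways)

  private
    if-≤ : ∀ {m n} {x y : ℕ} → m ℕ.≤ n → (if m ≤ᵇ n then x else y) ≡ x
    if-≤ {m} {n} m≤n with m ≤ᵇ n | ℕₚ.≤⇒≤ᵇ m≤n
    ... | true | _ = ≡.refl

    if-≰ : ∀ {m n} {x y : ℕ} → ¬ m ℕ.≤ n → (if m ≤ᵇ n then x else y) ≡ y
    if-≰ {m} {n} m≰n with m ≤ᵇ n in eq
    ... | false = ≡.refl
    ... | true  = ⊥-elim (m≰n (ℕₚ.≤ᵇ⇒≤ m n (≡.subst T (≡.sym eq) tt)))

    sumUpTo : (ℕ → ℕ) → (ℕ → ℕ) → ℕ → ℕ
    sumUpTo g h m = sum (map g (applyUpTo h m))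

    sumUpTo-cong : ∀ g g′ h h′ m → (∀ t → g (h t) ≡ g′ (h′ t)) → sumUpTo g h m ≡ sumUpTo g′ h′ m
    sumUpTo-cong g g′ h h′ zero    eq = ≡.refl
    sumUpTo-cong g g′ h h′ (suc m) eq =
      ≡.cong₂ ℕ._+_ (eq 0) (sumUpTo-cong g g′ (λ t → h (suc t)) (λ t → h′ (suc t)) m (λ t → eq (suc t)))

    sumUpTo-trim : ∀ g h m k → m ℕ.≤ k → (∀ t → m ℕ.≤ t → g (h t) ≡ 0) → sumUpTo g h k ≡ sumUpTo g h m
    sumUpTo-trim g h zero    zero    _         g≡0 = ≡.refl
    sumUpTo-trim g h zero    (suc k) _         g≡0 = ≡.trans
      (≡.cong₂ ℕ._+_ (g≡0 0 z≤n) (sumUpTo-trim g (λ t → h (suc t)) 0 k z≤n (λ t _ → g≡0 (suc t) z≤n))) ≡.refl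
    sumUpTo-trim g h (suc m) (suc k) (s≤s m≤k) g≡0 =
      ≡.cong (g (h 0) ℕ.+_) (sumUpTo-trim g (λ t → h (suc t)) m k m≤k (λ t m≤t → g≡0 (suc t) (s≤s m≤t)))

    term : ℕ → ℕ → List ℕ → ℕ → ℕ
    term n v vs t = if t ℕ.* v ≤ᵇ n then ways (n ∸ t ℕ.* v) vs else 0

  ways-< : ∀ n v vs → n ℕ.< v → ways n (v ∷ vs) ≡ ways n vs
  ways-< n v vs n<v = ≡.trans
    (≡.cong (ways n vs ℕ.+_) (sumUpTo-trim (term n v vs) suc 0 n z≤n λ t _ →
      if-≰ {suc t ℕ.* v} λ le → ℕₚ.<⇒≱ n<v (ℕₚ.≤-trans (ℕₚ.m≤m+n v (t ℕ.* v)) le)))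
    (ℕₚ.+-identityʳ _)

  ways-+ : ∀ n v vs → 1 ℕ.≤ v → ways (v ℕ.+ n) (v ∷ vs) ≡ ways (v ℕ.+ n) vs ℕ.+ ways n (v ∷ vs)
  ways-+ n v vs 1≤v = ≡.cong (ways (v ℕ.+ n) vs ℕ.+_) (≡.trans
    -- Multiplicities t + 1 with t > n cannot fit, since v ≥ 1; dropping them makes the range agree
    -- with that for total n.
    (sumUpTo-trim (term (v ℕ.+ n) v vs) suc (suc n) (v ℕ.+ n) (ℕₚ.+-monoˡ-≤ n 1≤v) λ t n<t →
      if-≰ {suc t ℕ.* v} λ le → ℕₚ.<⇒≱ (ℕₚ.≤-trans n<t (ℕₚ.m≤m*n t v ⦃ ℕ.>-nonZero 1≤v ⦄)) (ℕₚ.+-cancelˡ-≤ v _ _ le))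
    (sumUpTo-cong (term (v ℕ.+ n) v vs) (term n v vs) suc (λ t → t) (suc n) shift))
    where
    shift : ∀ t → term (v ℕ.+ n) v vs (suc t) ≡ term n v vs t
    shift t with t ℕ.* v ℕₚ.≤? n
    ... | yes le = ≡.trans (if-≤ (ℕₚ.+-monoʳ-≤ v le))
      (≡.trans (≡.cong (λ m → ways m vs) (ℕₚ.[m+n]∸[m+o]≡n∸o v n (t ℕ.* v))) (≡.sym (if-≤ le)))
    ... | no gt = ≡.trans (if-≰ {suc t ℕ.* v} λ le → gt (ℕₚ.+-cancelˡ-≤ v _ _ le)) (≡.sym (if-≰ gt))

-- Integer constants, finite sums and finite products in a commutative ring.

module RingTools (R : CommutativeRing 0ℓ 0ℓ) where

  open CommutativeRing R public renaming (zero to *-zero)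
  open import Algebra.Properties.Ring ring public
    using (-‿involutive; -0#≈0#; -‿distribˡ-*; -‿distribʳ-*)
  open import Algebra.Properties.CommutativeSemiring.Exp commutativeSemiring public
  open import Relation.Binary.Reasoning.Setoid setoid public

  -- Defined so that nat 1 and ι (+ 1) are 1# definitionally, which lets the solver's constants match 1#.
  nat : ℕ → Carrier
  nat zero          = 0#
  nat (suc zero)    = 1#
  nat (suc (suc n)) = 1# + nat (suc n)

  ι : ℤ → Carrier
  ι (+ n)    = nat n
  ι -[1+ n ] = - nat (suc n)

  nat-suc : ∀ n → nat (suc n) ≈ 1# + nat n
  nat-suc zero    = sym (+-identityʳ 1#)
  nat-suc (suc n) = refl

  nat-+ : ∀ m n → nat (m ℕ.+ n) ≈ nat m + nat n
  nat-+ zero    n = sym (+-identityˡ _)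
  nat-+ (suc m) n = begin
    nat (suc m ℕ.+ n)      ≈⟨ nat-suc (m ℕ.+ n) ⟩
    1# + nat (m ℕ.+ n)     ≈⟨ +-congˡ (nat-+ m n) ⟩
    1# + (nat m + nat n)   ≈⟨ +-assoc _ _ _ ⟨
    (1# + nat m) + nat n   ≈⟨ +-congʳ (nat-suc m) ⟨
    nat (suc m) + nat n    ∎

  private
    open import Algebra.Properties.AbelianGroup +-abelianGroup using (⁻¹-∙-comm)

    cancel-1 : ∀ x y → (1# + x) - (1# + y) ≈ x - y
    cancel-1 x y = begin
      (1# + x) - (1# + y)      ≈⟨ +-cong (+-comm 1# x) (sym (⁻¹-∙-comm 1# y)) ⟩
      (x + 1#) + (- 1# + - y)  ≈⟨ +-assoc x 1# _ ⟩
      x + (1# + (- 1# + - y))  ≈⟨ +-congˡ (+-assoc 1# (- 1#) (- y)) ⟨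
      x + ((1# - 1#) + - y)    ≈⟨ +-congˡ (+-congʳ (-‿inverseʳ 1#)) ⟩
      x + (0# + - y)           ≈⟨ +-congˡ (+-identityˡ (- y)) ⟩
      x - y                    ∎

    ι-⊖ : ∀ m n → ι (m ⊖ n) ≈ nat m - nat n
    ι-⊖ zero    zero    = sym (-‿inverseʳ 0#)
    ι-⊖ zero    (suc n) = sym (+-identityˡ _)
    ι-⊖ (suc m) zero    = sym (trans (+-congˡ -0#≈0#) (+-identityʳ _))
    ι-⊖ (suc m) (suc n) = begin
      ι (suc m ⊖ suc n)                ≡⟨ ≡.cong ι (ℤₚ.[1+m]⊖[1+n]≡m⊖n m n) ⟩
      ι (m ⊖ n)                        ≈⟨ ι-⊖ m n ⟩
      nat m - nat n                    ≈⟨ cancel-1 (nat m) (nat n) ⟨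
      (1# + nat m) - (1# + nat n)      ≈⟨ +-cong (nat-suc m) (-‿cong (nat-suc n)) ⟨
      nat (suc m) - nat (suc n)        ∎

  ι-+ : ∀ i j → ι (i ℤ.+ j) ≈ ι i + ι j
  ι-+ (+ m)    (+ n)    = nat-+ m n
  ι-+ (+ m)    -[1+ n ] = ι-⊖ m (suc n)
  ι-+ -[1+ m ] (+ n)    = trans (ι-⊖ n (suc m)) (+-comm _ _)
  ι-+ -[1+ m ] -[1+ n ] = begin
    - nat (suc (suc (m ℕ.+ n)))      ≡⟨ ≡.cong (λ k → - nat (suc k)) (ℕₚ.+-suc m n) ⟨
    - nat (suc m ℕ.+ suc n)          ≈⟨ -‿cong (nat-+ (suc m) (suc n)) ⟩
    - (nat (suc m) + nat (suc n))    ≈⟨ ⁻¹-∙-comm _ _ ⟨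
    - nat (suc m) - nat (suc n)      ∎

  ι-neg : ∀ i → ι (ℤ.- i) ≈ - ι i
  ι-neg (+ zero)  = sym -0#≈0#
  ι-neg (+ suc n) = refl
  ι-neg -[1+ n ]  = sym (-‿involutive _)

  private
    ι-+* : ∀ m j → ι (+ m ℤ.* j) ≈ ι (+ m) * ι j
    ι-+* zero    j = sym (zeroˡ (ι j))
    ι-+* (suc m) j = begin
      ι (+ suc m ℤ.* j)          ≡⟨ ≡.cong ι (ℤₚ.suc-* (+ m) j) ⟩
      ι (j ℤ.+ + m ℤ.* j)        ≈⟨ ι-+ j (+ m ℤ.* j) ⟩
      ι j + ι (+ m ℤ.* j)        ≈⟨ +-cong (sym (*-identityˡ (ι j))) (ι-+* m j) ⟩
      1# * ι j + nat m * ι j     ≈⟨ distribʳ (ι j) 1# (nat m) ⟨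
      (1# + nat m) * ι j         ≈⟨ *-congʳ (nat-suc m) ⟨
      ι (+ suc m) * ι j          ∎

  ι-* : ∀ i j → ι (i ℤ.* j) ≈ ι i * ι j
  ι-* (+ m)    j = ι-+* m j
  ι-* -[1+ m ] j = begin
    ι (-[1+ m ] ℤ.* j)          ≡⟨ ≡.cong ι (ℤₚ.neg-distribˡ-* (+ suc m) j) ⟨
    ι (ℤ.- (+ suc m ℤ.* j))     ≈⟨ ι-neg (+ suc m ℤ.* j) ⟩
    - ι (+ suc m ℤ.* j)         ≈⟨ -‿cong (ι-+* (suc m) j) ⟩
    - (ι (+ suc m) * ι j)       ≈⟨ -‿distribˡ-* _ _ ⟩
    ι -[1+ m ] * ι j            ∎

  private
    ι-morphism : ℤ.+-*-rawRing -Raw-AlmostCommutative⟶ fromCommutativeRing R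
    ι-morphism = record
      { ⟦_⟧ = ι ; +-homo = ι-+ ; *-homo = ι-* ; -‿homo = ι-neg
      ; 0-homo = refl ; 1-homo = refl }

    _ι≟_ : ∀ i j → Maybe (ι i ≈ ι j)
    i ι≟ j with i ℤₚ.≟ j
    ... | yes i≡j = just (reflexive (≡.cong ι i≡j))
    ... | no _    = nothing

  open import Algebra.Solver.Ring ℤ.+-*-rawRing (fromCommutativeRing R) ι-morphism _ι≟_ public
    using (solve; _:=_; _:+_; _:*_; _:-_; :-_; con)

  Σ< : ℕ → (ℕ → Carrier) → Carrier
  Σ< zero    f = 0#
  Σ< (suc n) f = Σ< n f + f n

  Π< : ℕ → (ℕ → Carrier) → Carrier
  Π< zero    f = 1#
  Π< (suc n) f = Π< n f * f n

  Σ<-cong : ∀ n {f g} → (∀ i → i ℕ.< n → f i ≈ g i) → Σ< n f ≈ Σ< n g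
  Σ<-cong zero    f≈g = refl
  Σ<-cong (suc n) f≈g = +-cong (Σ<-cong n λ i i<n → f≈g i (ℕₚ.m<n⇒m<1+n i<n)) (f≈g n ℕₚ.≤-refl)

  Σ<-0 : ∀ n → Σ< n (λ _ → 0#) ≈ 0#
  Σ<-0 zero    = refl
  Σ<-0 (suc n) = trans (+-identityʳ _) (Σ<-0 n)

  Σ<-+ : ∀ n f g → Σ< n (λ i → f i + g i) ≈ Σ< n f + Σ< n g
  Σ<-+ zero    f g = sym (+-identityʳ 0#)
  Σ<-+ (suc n) f g = trans (+-congʳ (Σ<-+ n f g))
    (solve 4 (λ a b c d → (a :+ b) :+ (c :+ d) := (a :+ c) :+ (b :+ d)) refl (Σ< n f) (Σ< n g) (f n) (g n))

  Σ<-*ˡ : ∀ n c f → Σ< n (λ i → c * f i) ≈ c * Σ< n f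
  Σ<-*ˡ zero    c f = sym (zeroʳ c)
  Σ<-*ˡ (suc n) c f = trans (+-congʳ (Σ<-*ˡ n c f)) (sym (distribˡ c (Σ< n f) (f n)))

  Π<-cong : ∀ n {f g} → (∀ i → i ℕ.< n → f i ≈ g i) → Π< n f ≈ Π< n g
  Π<-cong zero    f≈g = refl
  Π<-cong (suc n) f≈g = *-cong (Π<-cong n λ i i<n → f≈g i (ℕₚ.m<n⇒m<1+n i<n)) (f≈g n ℕₚ.≤-refl)

  Π<-* : ∀ n f g → Π< n (λ i → f i * g i) ≈ Π< n f * Π< n g
  Π<-* zero    f g = sym (*-identityʳ 1#)
  Π<-* (suc n) f g = trans (*-congʳ (Π<-* n f g))
    (solve 4 (λ a b c d → (a :* b) :* (c :* d) := (a :* c) :* (b :* d)) refl (Π< n f) (Π< n g) (f n) (g n))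

  ^-merge : ∀ x m n {k} → m ℕ.+ n ≡ k → x ^ m * x ^ n ≈ x ^ k
  ^-merge x m n ≡.refl = sym (^-homo-* x m n)

  Σ<-head : ∀ n {f} → (∀ i → i ℕ.< n → f (suc i) ≈ 0#) → Σ< (suc n) f ≈ f 0
  Σ<-head zero    f≈0 = +-identityˡ _
  Σ<-head (suc n) f≈0 =
    trans (+-cong (Σ<-head n λ i i<n → f≈0 i (ℕₚ.m<n⇒m<1+n i<n)) (f≈0 n ℕₚ.≤-refl)) (+-identityʳ _)

  Π<-head : ∀ n f → Π< (suc n) f ≈ f 0 * Π< n (λ i → f (suc i))
  Π<-head zero    f = *-comm _ _
  Π<-head (suc n) f = trans (*-congʳ (Π<-head n f)) (*-assoc _ _ _)

  Π<-^ : ∀ n f k → Π< n (λ i → f i ^ k) ≈ Π< n f ^ k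
  Π<-^ n f zero    = one n
    where
    one : ∀ n → Π< n (λ _ → 1#) ≈ 1#
    one zero    = refl
    one (suc n) = trans (*-identityʳ _) (one n)
  Π<-^ n f (suc k) = trans (Π<-* n f (λ i → f i ^ k)) (*-congˡ (Π<-^ n f k))

  ε : ℕ → Carrier
  ε zero    = 1#
  ε (suc n) = - ε n

  -- For d = - z - z⁻¹ the k-th term is (-1)^k (z^k + z^(k-1) + ... + z^-k), a Chebyshev-type
  -- polynomial in d.
  dualSeq : Carrier → ℕ → Carrier
  dualSeq d zero          = 1#
  dualSeq d (suc zero)    = d - 1#
  dualSeq d (suc (suc k)) = d * dualSeq d (suc k) - dualSeq d k

-- Gaussian binomials, the finite triple product and Shanks' identity.

module QSeries (R : CommutativeRing 0ℓ 0ℓ) (b : CommutativeRing.Carrier R) where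

  open RingTools R
  open Exponents

  -- The q-Pochhammer symbol (b^(a+1); b)_k.
  poch : ℕ → ℕ → Carrier
  poch a k = Π< k (λ i → 1# - b ^ (suc a ℕ.+ i))

  poch-suc : ∀ a k → poch a (suc k) ≈ (1# - b ^ suc a) * poch (suc a) k
  poch-suc a zero = trans (*-comm _ _) (*-congʳ (+-congˡ (-‿cong (^-congʳ b (ℕₚ.+-identityʳ (suc a))))))
  poch-suc a (suc k) = begin
    poch a (suc k) * (1# - b ^ (suc a ℕ.+ suc k))
      ≈⟨ *-cong (poch-suc a k) (+-congˡ (-‿cong (^-congʳ b (ℕₚ.+-suc (suc a) k)))) ⟩
    ((1# - b ^ suc a) * poch (suc a) k) * (1# - b ^ (suc (suc a) ℕ.+ k))
      ≈⟨ *-assoc _ _ _ ⟩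
    (1# - b ^ suc a) * poch (suc a) (suc k) ∎

  poch-+ : ∀ a k → poch 0 (a ℕ.+ k) ≈ poch 0 a * poch a k
  poch-+ a zero = trans (reflexive (≡.cong (poch 0) (ℕₚ.+-identityʳ a))) (sym (*-identityʳ _))
  poch-+ a (suc k) = begin
    poch 0 (a ℕ.+ suc k)                              ≡⟨ ≡.cong (poch 0) (ℕₚ.+-suc a k) ⟩
    poch 0 (a ℕ.+ k) * (1# - b ^ suc (a ℕ.+ k))       ≈⟨ *-congʳ (poch-+ a k) ⟩
    (poch 0 a * poch a k) * (1# - b ^ suc (a ℕ.+ k))  ≈⟨ *-assoc _ _ _ ⟩
    poch 0 a * poch a (suc k)                         ∎

  -- gauss m n is the Gaussian binomial coefficient [m+n choose m].
  gauss : ℕ → ℕ → Carrier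
  gauss zero    n       = 1#
  gauss (suc m) zero    = 1#
  gauss (suc m) (suc n) = gauss (suc m) n + b ^ suc n * gauss m (suc n)

  gauss-zeroʳ : ∀ m → gauss m 0 ≈ 1#
  gauss-zeroʳ zero    = refl
  gauss-zeroʳ (suc m) = refl

  -- The second q-Pascal rule, with the power of b on the other summand; together with the defining
  -- rule it yields symmetry.
  pascal : ∀ m n → gauss (suc m) (suc n) ≈ gauss m (suc n) + b ^ suc m * gauss (suc m) n
  pascal zero zero = refl
  pascal zero (suc n) = trans (+-congʳ (pascal zero n))
    (solve 3 (λ b g x → (con (+ 1) :+ b :* con (+ 1) :* g) :+ b :* x :* con (+ 1)
       := con (+ 1) :+ b :* con (+ 1) :* (g :+ x :* con (+ 1))) refl b (gauss 1 n) (b ^ suc n))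
  pascal (suc m) zero = trans (+-congˡ (*-congˡ (pascal m zero)))
    (solve 3 (λ b g x → con (+ 1) :+ b :* con (+ 1) :* (g :+ x :* con (+ 1))
       := (con (+ 1) :+ b :* con (+ 1) :* g) :+ b :* x :* con (+ 1)) refl b (gauss m 1) (b ^ suc m))
  pascal (suc m) (suc n) = trans (+-cong (pascal (suc m) n) (*-congˡ (pascal m (suc n))))
    (solve 6 (λ b x y u v w → (u :+ b :* x :* v) :+ b :* y :* (w :+ x :* u)
       := (u :+ b :* y :* w) :+ b :* x :* (v :+ y :* u)) refl
       b (b ^ suc m) (b ^ suc n) (gauss (suc m) (suc n)) (gauss (suc (suc m)) n) (gauss m (suc (suc n))))

  gauss-sym : ∀ m n → gauss m n ≈ gauss n m
  gauss-sym zero    n       = sym (gauss-zeroʳ n)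
  gauss-sym (suc m) zero    = refl
  gauss-sym (suc m) (suc n) =
    trans (+-cong (gauss-sym (suc m) n) (*-congˡ (gauss-sym m (suc n)))) (sym (pascal n m))

  -- The ratio of neighbouring Gaussian binomials, cleared of denominators because nothing is
  -- assumed invertible.
  gauss-step : ∀ m n → (1# - b ^ suc m) * gauss (suc m) n ≈ gauss m n * (1# - b ^ (suc n ℕ.+ m))
  gauss-step m zero = trans (*-identityʳ _) (sym (trans (*-congʳ (gauss-zeroʳ m)) (*-identityˡ _)))
  gauss-step m (suc n) = begin
    (1# - y) * (g + x * h)
      ≈⟨ solve 4 (λ x y g h → (con (+ 1) :- y) :* (g :+ x :* h) := (g :+ x :* h) :- y :* g :- y :* x :* h) refl x y g h ⟩
    (g + x * h) - y * g - y * x * h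
      ≈⟨ +-congʳ (+-congʳ (pascal m n)) ⟩
    (h + y * g) - y * g - y * x * h
      ≈⟨ solve 4 (λ x y g h → (h :+ y :* g) :- y :* g :- y :* x :* h := h :* (con (+ 1) :- x :* y)) refl x y g h ⟩
    h * (1# - x * y)
      ≈⟨ *-congˡ (+-congˡ (-‿cong (^-merge b (suc n) (suc m) (≡.cong suc (ℕₚ.+-suc n m))))) ⟩
    h * (1# - b ^ (suc (suc n) ℕ.+ m)) ∎
    where
    x = b ^ suc n
    y = b ^ suc m
    g = gauss (suc m) n
    h = gauss m (suc n)

  poch-gauss : ∀ m n → poch 0 m * gauss m n ≈ poch n m
  poch-gauss zero    n = *-identityʳ 1#
  poch-gauss (suc m) n = begin
    (poch 0 m * (1# - b ^ suc m)) * gauss (suc m) n   ≈⟨ *-assoc _ _ _ ⟩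
    poch 0 m * ((1# - b ^ suc m) * gauss (suc m) n)   ≈⟨ *-congˡ (gauss-step m n) ⟩
    poch 0 m * (gauss m n * (1# - b ^ (suc n ℕ.+ m))) ≈⟨ *-assoc _ _ _ ⟨
    (poch 0 m * gauss m n) * (1# - b ^ (suc n ℕ.+ m)) ≈⟨ *-congʳ (poch-gauss m n) ⟩
    poch n m * (1# - b ^ (suc n ℕ.+ m)) ∎

  -- coef n k = b^(k(k+1)/2) [2n+1 choose n-k] (see coef-gauss), defined by the recurrence dual to
  -- multiplication of Σ s_k coef n k by 1 + d Q + Q², Q = b^(n+1).
  coef : ℕ → ℕ → Carrier
  coef zero    zero    = 1#
  coef zero    (suc k) = 0#
  coef (suc n) zero    = (1# + b ^ suc n * b ^ suc n) * coef n 0 + b ^ suc n * (coef n 1 + coef n 0)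
  coef (suc n) (suc k) = (1# + b ^ suc n * b ^ suc n) * coef n (suc k) + b ^ suc n * (coef n (suc (suc k)) + coef n k)

  coef-zero : ∀ n k → n ℕ.< k → coef n k ≈ 0#
  coef-zero zero    (suc k) _         = refl
  coef-zero (suc n) (suc k) (s≤s n<k) = trans
    (+-cong (*-congˡ (coef-zero n (suc k) (ℕₚ.m<n⇒m<1+n n<k)))
            (*-congˡ (+-cong (coef-zero n (suc (suc k)) (ℕₚ.m<n⇒m<1+n (ℕₚ.m<n⇒m<1+n n<k))) (coef-zero n k n<k))))
    (solve 1 (λ q → (con (+ 1) :+ q :* q) :* con (+ 0) :+ q :* (con (+ 0) :+ con (+ 0)) := con (+ 0)) refl (b ^ suc n))

  -- Lower index decreased by one, with value 0 at the boundary, so that a single recurrence also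
  -- covers m = 0.
  gauss⁻ : ℕ → ℕ → Carrier
  gauss⁻ zero    n = 0#
  gauss⁻ (suc m) n = gauss m n

  gauss-up : ∀ m n → gauss m (suc n) ≈ gauss m n + b ^ suc n * gauss⁻ m (suc n)
  gauss-up zero    n = sym (trans (+-congˡ (zeroʳ _)) (+-identityʳ _))
  gauss-up (suc m) n = refl

  -- Both q-Pascal rules raise the upper index by two, matching the step from 2n + 1 to 2n + 3 in
  -- `coef`.
  gauss-double : ∀ m n → gauss (suc m) (suc (suc n)) ≈
    (gauss m (suc n) + b ^ suc (suc n) * gauss⁻ m (suc (suc n))) + b ^ suc m * (gauss (suc m) n + b ^ suc n * gauss m (suc n))
  gauss-double m n = trans (pascal m (suc n)) (+-congʳ (gauss-up m (suc n)))

  -- The recurrence of `coef` expands into the four terms of `gauss-double` once powers of b are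
  -- matched. Passing m = n - k and s = n + k with equations keeps truncated subtraction out of the
  -- exponents.
  coef-gauss : ∀ n m k s → m ℕ.+ k ≡ n → n ℕ.+ k ≡ s → coef n k ≈ b ^ tri k * gauss m (suc s)
  coef-gauss zero zero zero s ≡.refl ≡.refl = sym (*-identityʳ 1#)
  coef-gauss (suc n) zero (suc k) s ≡.refl _ = begin
    (1# + Q * Q) * coef n (suc n) + Q * (coef n (suc (suc n)) + coef n n)
      ≈⟨ +-cong (*-congˡ (coef-zero n (suc n) ℕₚ.≤-refl))
           (*-congˡ (+-cong (coef-zero n (suc (suc n)) (ℕₚ.m<n⇒m<1+n ℕₚ.≤-refl))
                            (coef-gauss n zero n _ ≡.refl ≡.refl))) ⟩
    (1# + Q * Q) * 0# + Q * (0# + b ^ tri n * 1#)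
      ≈⟨ solve 2 (λ Q t → (con (+ 1) :+ Q :* Q) :* con (+ 0) :+ Q :* (con (+ 0) :+ t :* con (+ 1)) := Q :* t :* con (+ 1))
           refl Q (b ^ tri n) ⟩
    Q * b ^ tri n * 1#
      ≈⟨ *-congʳ (^-merge b (suc n) (tri n) ≡.refl) ⟩
    b ^ tri (suc n) * 1# ∎
    where Q = b ^ suc n
  coef-gauss (suc n) (suc m) k (suc s) m+k≡n n+k≡s = step k m (ℕₚ.suc-injective m+k≡n) (ℕₚ.suc-injective n+k≡s)
    where
    Q = b ^ suc n

    above : ∀ m k s → m ℕ.+ k ≡ n → n ℕ.+ k ≡ s → coef n (suc k) ≈ b ^ tri (suc k) * gauss⁻ m (suc (suc s))
    above zero    k s ≡.refl _ = trans (coef-zero n (suc k) ℕₚ.≤-refl) (sym (zeroʳ _))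
    above (suc m) k s m+k≡n n+k≡s =
      coef-gauss n m (suc k) (suc s) (≡.trans (ℕₚ.+-suc m k) m+k≡n) (≡.trans (ℕₚ.+-suc n k) (≡.cong suc n+k≡s))

    step : ∀ k m {s} → m ℕ.+ k ≡ n → n ℕ.+ k ≡ s → coef (suc n) k ≈ b ^ tri k * gauss (suc m) (suc (suc s))
    step zero m m+0≡n n+0≡s with ≡.trans (≡.sym (ℕₚ.+-identityʳ m)) m+0≡n | ≡.trans (≡.sym (ℕₚ.+-identityʳ n)) n+0≡s
    ... | ≡.refl | ≡.refl = begin
      (1# + Q * Q) * coef n 0 + Q * (coef n 1 + coef n 0)
        ≈⟨ +-cong (*-congˡ here) (*-congˡ (+-cong (above n 0 n m+0≡n n+0≡s) here)) ⟩
      (1# + Q * Q) * (1# * G) + Q * (b ^ 1 * G⁻ + 1# * G)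
        ≈⟨ solve 4 (λ Q b G G⁻ → (con (+ 1) :+ Q :* Q) :* (con (+ 1) :* G) :+ Q :* (b :* con (+ 1) :* G⁻ :+ con (+ 1) :* G)
             := (G :+ b :* Q :* G⁻) :+ Q :* (G :+ Q :* G)) refl Q b G G⁻ ⟩
      (G + b ^ suc (suc n) * G⁻) + Q * (G + Q * G)
        -- The neighbour at index -1 is folded onto index 0: [2n+1 choose n] = [2n+1 choose n+1].
        ≈⟨ +-congˡ (*-congˡ (+-congʳ (gauss-sym n (suc n)))) ⟩
      (G + b ^ suc (suc n) * G⁻) + Q * (gauss (suc n) n + Q * G)
        ≈⟨ gauss-double n n ⟨
      gauss (suc n) (suc (suc n))
        ≈⟨ *-identityˡ _ ⟨
      1# * gauss (suc n) (suc (suc n)) ∎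
      where
      G    = gauss n (suc n)
      G⁻   = gauss⁻ n (suc (suc n))
      here = coef-gauss n n 0 n m+0≡n n+0≡s
    step (suc k) m {zero} m+k≡n n+k≡s with ≡.trans (≡.sym (ℕₚ.+-suc n k)) n+k≡s
    ... | ()
    step (suc k) m {suc s} m+k≡n n+k≡s = begin
      (1# + Q * Q) * coef n (suc k) + Q * (coef n (suc (suc k)) + coef n k)
        ≈⟨ +-cong (*-congˡ (coef-gauss n m (suc k) (suc s) m+k≡n n+k≡s))
             (*-congˡ (+-cong (above m (suc k) (suc s) m+k≡n n+k≡s)
               (coef-gauss n (suc m) k s (≡.trans (≡.sym (ℕₚ.+-suc m k)) m+k≡n)
                 (ℕₚ.suc-injective (≡.trans (≡.sym (ℕₚ.+-suc n k)) n+k≡s))))) ⟩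
      (1# + Q * Q) * (t * G) + Q * (b ^ tri (suc (suc k)) * G⁻ + b ^ tri k * G⁺)
        ≈⟨ solve 7 (λ Q t t⁺ t⁻ G G⁻ G⁺ → (con (+ 1) :+ Q :* Q) :* (t :* G) :+ Q :* (t⁺ :* G⁻ :+ t⁻ :* G⁺)
             := t :* G :+ (Q :* t⁺) :* G⁻ :+ (Q :* t⁻) :* G⁺ :+ t :* (Q :* Q) :* G)
             refl Q t (b ^ tri (suc (suc k))) (b ^ tri k) G G⁻ G⁺ ⟩
      t * G + (Q * b ^ tri (suc (suc k))) * G⁻ + (Q * b ^ tri k) * G⁺ + t * (Q * Q) * G
        ≈⟨ +-cong (+-cong (+-congˡ (*-congʳ e₁)) (*-congʳ e₂)) (*-congʳ (*-congˡ e₃)) ⟩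
      t * G + (t * b ^ suc (suc (suc s))) * G⁻ + (t * b ^ suc m) * G⁺ + t * (b ^ suc m * b ^ suc (suc s)) * G
        ≈⟨ solve 7 (λ t x y z G G⁻ G⁺ → t :* G :+ (t :* x) :* G⁻ :+ (t :* y) :* G⁺ :+ t :* (y :* z) :* G
             := t :* ((G :+ x :* G⁻) :+ y :* (G⁺ :+ z :* G)))
             refl t (b ^ suc (suc (suc s))) (b ^ suc m) (b ^ suc (suc s)) G G⁻ G⁺ ⟩
      t * ((G + b ^ suc (suc (suc s)) * G⁻) + b ^ suc m * (G⁺ + b ^ suc (suc s) * G))
        ≈⟨ *-congˡ (gauss-double m (suc s)) ⟨
      t * gauss (suc m) (suc (suc (suc s))) ∎
      where
      t  = b ^ tri (suc k)
      G  = gauss m (suc (suc s))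
      G⁻ = gauss⁻ m (suc (suc (suc s)))
      G⁺ = gauss (suc m) (suc s)
      exp₁ : ∀ n k t → suc n ℕ.+ (suc (suc k) ℕ.+ t) ≡ t ℕ.+ suc (suc (n ℕ.+ suc k))
      exp₁ = solve-∀
      exp₂ : ∀ m k t → suc (m ℕ.+ suc k) ℕ.+ t ≡ suc k ℕ.+ t ℕ.+ suc m
      exp₂ = solve-∀
      exp₃ : ∀ m k → suc (m ℕ.+ k) ℕ.+ suc (m ℕ.+ k) ≡ suc m ℕ.+ suc (m ℕ.+ k ℕ.+ k)
      exp₃ = solve-∀
      e₁ : Q * b ^ tri (suc (suc k)) ≈ t * b ^ suc (suc (suc s))
      e₁ = begin
        Q * b ^ tri (suc (suc k))                        ≈⟨ ^-merge b (suc n) _ (exp₁ n k (tri (suc k))) ⟩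
        b ^ (tri (suc k) ℕ.+ suc (suc (n ℕ.+ suc k)))    ≡⟨ ≡.cong (λ j → b ^ (tri (suc k) ℕ.+ suc (suc j))) n+k≡s ⟩
        b ^ (tri (suc k) ℕ.+ suc (suc (suc s)))          ≈⟨ ^-homo-* b (tri (suc k)) _ ⟩
        t * b ^ suc (suc (suc s))                        ∎
      e₂ : Q * b ^ tri k ≈ t * b ^ suc m
      e₂ = begin
        Q * b ^ tri k                                    ≈⟨ ^-merge b (suc n) (tri k) ≡.refl ⟩
        b ^ (suc n ℕ.+ tri k)                            ≡⟨ ≡.cong (λ j → b ^ (suc j ℕ.+ tri k)) m+k≡n ⟨
        b ^ (suc (m ℕ.+ suc k) ℕ.+ tri k)                ≡⟨ ≡.cong (b ^_) (exp₂ m k (tri k)) ⟩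
        b ^ (tri (suc k) ℕ.+ suc m)                      ≈⟨ ^-homo-* b (tri (suc k)) (suc m) ⟩
        t * b ^ suc m                                    ∎
      e₃ : Q * Q ≈ b ^ suc m * b ^ suc (suc s)
      e₃ = trans (^-merge b (suc n) (suc n) exponents) (^-homo-* b (suc m) (suc (suc s)))
        where
        exponents : suc n ℕ.+ suc n ≡ suc m ℕ.+ suc (suc s)
        exponents = ≡.subst (λ j → suc n ℕ.+ suc n ≡ suc m ℕ.+ suc j) n+k≡s
          (≡.subst (λ n → suc n ℕ.+ suc n ≡ suc m ℕ.+ suc (n ℕ.+ suc k)) m+k≡n (exp₃ m (suc k)))

  -- Summation by parts: the rule s_(k+1) + s_(k-1) = d s_k moves the neighbours of `coef` onto the
  -- weights, leaving a boundary term at K.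
  dualSeq-step : ∀ d n K → Σ< (suc K) (λ k → dualSeq d k * coef (suc n) k) ≈
    (1# + d * b ^ suc n + b ^ suc n * b ^ suc n) * Σ< (suc K) (λ k → dualSeq d k * coef n k)
      + b ^ suc n * (dualSeq d K * coef n (suc K) - dualSeq d (suc K) * coef n K)
  dualSeq-step d n zero = solve 4 (λ d Q x y →
      con (+ 0) :+ con (+ 1) :* ((con (+ 1) :+ Q :* Q) :* x :+ Q :* (y :+ x))
      := (con (+ 1) :+ d :* Q :+ Q :* Q) :* (con (+ 0) :+ con (+ 1) :* x)
           :+ Q :* (con (+ 1) :* y :- (d :- con (+ 1)) :* x))
    refl d (b ^ suc n) (coef n 0) (coef n 1)
  dualSeq-step d n (suc K) = trans (+-congʳ (dualSeq-step d n K))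
    (solve 8 (λ d Q S s s⁺ x x⁺ x⁺⁺ →
       ((con (+ 1) :+ d :* Q :+ Q :* Q) :* S :+ Q :* (s :* x⁺ :- s⁺ :* x))
         :+ s⁺ :* ((con (+ 1) :+ Q :* Q) :* x⁺ :+ Q :* (x⁺⁺ :+ x))
       := (con (+ 1) :+ d :* Q :+ Q :* Q) :* (S :+ s⁺ :* x⁺) :+ Q :* (s⁺ :* x⁺⁺ :- (d :* s⁺ :- s) :* x⁺))
    refl d (b ^ suc n) (Σ< (suc K) (λ k → dualSeq d k * coef n k))
      (dualSeq d K) (dualSeq d (suc K)) (coef n K) (coef n (suc K)) (coef n (suc (suc K))))

  -- A finite form of the Jacobi triple product Σ (-1)^k b^(k(k+1)/2) (z^k + … + z^-k) at d = - z - z⁻¹.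
  finiteTheta : ∀ d K n → n ℕ.≤ K →
    Σ< (suc K) (λ k → dualSeq d k * coef n k) ≈ Π< n (λ i → 1# + d * b ^ suc i + b ^ suc i * b ^ suc i)
  finiteTheta d K zero _ = trans (Σ<-head K (λ _ _ → zeroʳ _)) (*-identityʳ 1#)
  finiteTheta d K (suc n) n<K = begin
    Σ< (suc K) (λ k → dualSeq d k * coef (suc n) k)
      ≈⟨ dualSeq-step d n K ⟩
    F * Σ< (suc K) (λ k → dualSeq d k * coef n k) + b ^ suc n * (dualSeq d K * coef n (suc K) - dualSeq d (suc K) * coef n K)
      ≈⟨ +-cong (*-congˡ (finiteTheta d K n (ℕₚ.<⇒≤ n<K)))
           (*-congˡ (+-cong (*-congˡ (coef-zero n (suc K) (ℕₚ.m<n⇒m<1+n n<K))) (-‿cong (*-congˡ (coef-zero n K n<K))))) ⟩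
    F * P + b ^ suc n * (dualSeq d K * 0# - dualSeq d (suc K) * 0#)
      ≈⟨ solve 5 (λ F P q x y → F :* P :+ q :* (x :* con (+ 0) :- y :* con (+ 0)) := P :* F)
           refl F P (b ^ suc n) (dualSeq d K) (dualSeq d (suc K)) ⟩
    P * F ∎
    where
    F = 1# + d * b ^ suc n + b ^ suc n * b ^ suc n
    P = Π< n (λ i → 1# + d * b ^ suc i + b ^ suc i * b ^ suc i)

  -- Σ (-1)^l b^(l(3l+1)/2) over -n ≤ l < n, the terms l and -1-l being paired.
  pentagonal : ℕ → Carrier
  pentagonal n = Σ< n (λ l → ε l * b ^ (l ℕ.* l ℕ.+ tri l) + ε (suc l) * b ^ (suc l ℕ.* suc l ℕ.+ tri l))

  -- Shanks' identity: the term s = 0 is poch 0 n and the others are divisible by b^n.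
  shanksTerm : ℕ → ℕ → Carrier
  shanksTerm n s = ε s * poch s (n ℕ.∸ s) * b ^ (s ℕ.* n ℕ.+ tri s)

  -- Induction on the cutoff j: the remainder at j and the change of term j + 1 combine into the
  -- remainder at j + 1. At j = m the remainder is a single pentagonal term.
  shanks-telescope : ∀ m j → j ℕ.≤ m →
    Σ< (suc j) (λ s → shanksTerm (suc m) s) ≈
    Σ< (suc j) (λ s → shanksTerm m s) - ε j * poch j (m ℕ.∸ j) * b ^ (suc j ℕ.* suc m ℕ.+ tri j)
  shanks-telescope m zero _ = begin
    0# + 1# * (poch 0 m * (1# - b ^ suc m)) * 1#
      ≈⟨ solve 2 (λ P q → con (+ 0) :+ con (+ 1) :* (P :* (con (+ 1) :- q)) :* con (+ 1)
           := (con (+ 0) :+ con (+ 1) :* P :* con (+ 1)) :- con (+ 1) :* P :* q) refl (poch 0 m) (b ^ suc m) ⟩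
    (0# + 1# * poch 0 m * 1#) - 1# * poch 0 m * b ^ suc m
      ≡⟨ ≡.cong (λ e → (0# + 1# * poch 0 m * 1#) - 1# * poch 0 m * b ^ e) (exponent m) ⟩
    (0# + 1# * poch 0 m * 1#) - 1# * poch 0 m * b ^ (1 ℕ.* suc m ℕ.+ 0) ∎
    where
    exponent : ∀ m → suc m ≡ 1 ℕ.* suc m ℕ.+ 0
    exponent = solve-∀
  shanks-telescope m (suc j) j<m = begin
    Σ< (suc j) (shanksTerm (suc m)) + ε (suc j) * poch (suc j) (m ℕ.∸ j) * u′
      ≈⟨ +-cong (shanks-telescope m j (ℕₚ.<⇒≤ j<m)) (*-congʳ (*-congˡ stepUp)) ⟩
    (S - ε j * poch j (m ℕ.∸ j) * v) + - ε j * (P * (1# - c)) * u′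
      ≈⟨ +-cong (+-congˡ (-‿cong (*-congʳ (*-congˡ stepDown)))) (*-congˡ u′≈au) ⟩
    (S - ε j * ((1# - a) * P) * v) + - ε j * (P * (1# - c)) * (a * u)
      ≈⟨ +-congʳ (+-congˡ (-‿cong (*-congˡ v≈u))) ⟩
    (S - ε j * ((1# - a) * P) * u) + - ε j * (P * (1# - c)) * (a * u)
      ≈⟨ solve 6 (λ S e a c P u →
           (S :- e :* ((con (+ 1) :- a) :* P) :* u) :+ (:- e) :* (P :* (con (+ 1) :- c)) :* (a :* u)
           := (S :+ (:- e) :* P :* u) :- (:- e) :* P :* (c :* (a :* u))) refl S (ε j) a c P u ⟩
    (S + - ε j * P * u) - - ε j * P * (c * (a * u))
      ≈⟨ +-congˡ (-‿cong (*-congˡ (*-congˡ u′≈au))) ⟨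
    (S + - ε j * P * u) - - ε j * P * (c * u′)
      ≈⟨ +-congˡ (-‿cong (*-congˡ (^-merge b (suc m) _ (exponent₃ m j (tri (suc j)))))) ⟩
    (S + - ε j * P * u) - - ε j * P * b ^ (suc (suc j) ℕ.* suc m ℕ.+ tri (suc j)) ∎
    where
    S = Σ< (suc j) (shanksTerm m)
    P = poch (suc j) (m ℕ.∸ suc j)
    a = b ^ suc j
    c = b ^ suc m
    u = b ^ (suc j ℕ.* m ℕ.+ tri (suc j))
    u′ = b ^ (suc j ℕ.* suc m ℕ.+ tri (suc j))
    v = b ^ (suc j ℕ.* suc m ℕ.+ tri j)
    exponent₁ : ∀ m j t → suc j ℕ.+ (suc j ℕ.* m ℕ.+ t) ≡ suc j ℕ.* suc m ℕ.+ t
    exponent₁ = solve-∀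
    exponent₂ : ∀ m j t → suc j ℕ.* suc m ℕ.+ t ≡ suc j ℕ.* m ℕ.+ (suc j ℕ.+ t)
    exponent₂ = solve-∀
    exponent₃ : ∀ m j t → suc m ℕ.+ (suc j ℕ.* suc m ℕ.+ t) ≡ suc (suc j) ℕ.* suc m ℕ.+ t
    exponent₃ = solve-∀
    gap : m ℕ.∸ j ≡ suc (m ℕ.∸ suc j)
    gap = ℕₚ.+-∸-assoc 1 j<m
    u′≈au : u′ ≈ a * u
    u′≈au = sym (^-merge b (suc j) _ (exponent₁ m j (tri (suc j))))
    v≈u : v ≈ u
    v≈u = ^-congʳ b (exponent₂ m j (tri j))
    stepUp : poch (suc j) (m ℕ.∸ j) ≈ P * (1# - c)
    stepUp = trans (reflexive (≡.cong (poch (suc j)) gap))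
      (*-congˡ (+-congˡ (-‿cong (^-congʳ b (≡.cong suc (ℕₚ.m+[n∸m]≡n j<m))))))
    stepDown : poch j (m ℕ.∸ j) ≈ (1# - a) * P
    stepDown = trans (reflexive (≡.cong (poch j) gap)) (poch-suc j (m ℕ.∸ suc j))

  -- Each level contributes two new pentagonal terms: the telescoped remainder completes the pair l
  -- = m, and the new last summand opens the pair l = m + 1.
  shanks : ∀ n → Σ< (suc n) (shanksTerm n) ≈ pentagonal n + ε n * b ^ (n ℕ.* n ℕ.+ tri n)
  shanks zero = +-congˡ (*-congʳ (*-identityʳ 1#))
  shanks (suc m) = begin
    Σ< (suc m) (shanksTerm (suc m)) + - ε m * poch (suc m) (m ℕ.∸ m) * z
      ≈⟨ +-cong (shanks-telescope m m ℕₚ.≤-refl) (*-congʳ (*-congˡ (reflexive (≡.cong (poch (suc m)) (ℕₚ.n∸n≡0 m))))) ⟩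
    (Σ< (suc m) (shanksTerm m) - ε m * poch m (m ℕ.∸ m) * y) + - ε m * 1# * z
      ≈⟨ +-congʳ (+-cong (shanks m) (-‿cong (*-congʳ (*-congˡ (reflexive (≡.cong (poch m) (ℕₚ.n∸n≡0 m))))))) ⟩
    ((pentagonal m + ε m * x) - ε m * 1# * y) + - ε m * 1# * z
      ≈⟨ solve 5 (λ p e x y z → ((p :+ e :* x) :- e :* con (+ 1) :* y) :+ (:- e) :* con (+ 1) :* z
           := (p :+ (e :* x :+ (:- e) :* y)) :+ (:- e) :* z) refl (pentagonal m) (ε m) x y z ⟩
    pentagonal (suc m) + ε (suc m) * z ∎
    where
    x = b ^ (m ℕ.* m ℕ.+ tri m)
    y = b ^ (suc m ℕ.* suc m ℕ.+ tri m)
    z = b ^ (suc m ℕ.* suc m ℕ.+ tri (suc m))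

  -- Infinite identities as finite ones modulo b^N.

  module Nilpotent (N : ℕ) (b^N≈0 : b ^ N ≈ 0#) where

    high : ∀ {n} → N ℕ.≤ n → b ^ n ≈ 0#
    high {n} N≤n = begin
      b ^ n                    ≡⟨ ≡.cong (b ^_) (ℕₚ.m+[n∸m]≡n N≤n) ⟨
      b ^ (N ℕ.+ (n ℕ.∸ N))    ≈⟨ ^-homo-* b N (n ℕ.∸ N) ⟩
      b ^ N * b ^ (n ℕ.∸ N)    ≈⟨ *-congʳ b^N≈0 ⟩
      0# * b ^ (n ℕ.∸ N)       ≈⟨ zeroˡ _ ⟩
      0#                       ∎

    -- Each factor of `poch a k` differs from 1 by a multiple of b^(a+1), which b^j kills.
    absorb : ∀ j a k → N ℕ.≤ j ℕ.+ suc a → b ^ j * poch a k ≈ b ^ j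
    absorb j a zero    _   = *-identityʳ _
    absorb j a (suc k) N≤  = begin
      b ^ j * (poch a k * (1# - b ^ (suc a ℕ.+ k)))    ≈⟨ *-assoc _ _ _ ⟨
      (b ^ j * poch a k) * (1# - b ^ (suc a ℕ.+ k))    ≈⟨ *-congʳ (absorb j a k N≤) ⟩
      b ^ j * (1# - b ^ (suc a ℕ.+ k))
        ≈⟨ solve 2 (λ x y → x :* (con (+ 1) :- y) := x :- x :* y) refl _ _ ⟩
      b ^ j - b ^ j * b ^ (suc a ℕ.+ k)                ≈⟨ +-congˡ (-‿cong (^-merge b j _ ≡.refl)) ⟩
      b ^ j - b ^ (j ℕ.+ (suc a ℕ.+ k))
        ≈⟨ +-congˡ (-‿cong (high (ℕₚ.≤-trans N≤ (ℕₚ.+-monoʳ-≤ j (ℕₚ.m≤m+n (suc a) k))))) ⟩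
      b ^ j - 0#                                       ≈⟨ solve 1 (λ x → x :- con (+ 0) := x) refl _ ⟩
      b ^ j                                            ∎

    -- The product formula turns the Gaussian binomial into Pochhammer symbols. Both surplus symbols
    -- are absorbed by b^(k(k+1)/2): the first because k(k+1)/2 + (N - k) ≥ N, the second because
    -- its powers already exceed N.
    poch-coef : ∀ k → k ℕ.≤ N → poch 0 N * coef N k ≈ b ^ tri k
    poch-coef k k≤N = begin
      poch 0 N * coef N k
        ≈⟨ *-cong (trans (reflexive (≡.cong (poch 0) (≡.sym a+k≡N))) (poch-+ a k)) (coef-gauss N a k _ a+k≡N ≡.refl) ⟩
      (poch 0 a * poch a k) * (b ^ tri k * gauss a β)
        ≈⟨ solve 4 (λ p r t g → (p :* r) :* (t :* g) := (t :* r) :* (p :* g)) refl _ _ _ _ ⟩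
      (b ^ tri k * poch a k) * (poch 0 a * gauss a β)
        ≈⟨ *-cong (absorb (tri k) a k N≤tri+a) (poch-gauss a β) ⟩
      b ^ tri k * poch β a
        ≈⟨ absorb (tri k) β a (ℕₚ.≤-trans (ℕₚ.≤-trans (ℕₚ.m≤m+n N k) (ℕₚ.m≤n+m _ 2)) (ℕₚ.m≤n+m _ (tri k))) ⟩
      b ^ tri k ∎
      where
      a = N ℕ.∸ k
      β = suc (N ℕ.+ k)
      a+k≡N : a ℕ.+ k ≡ N
      a+k≡N = ℕₚ.m∸n+n≡m k≤N
      N≤tri+a : N ℕ.≤ tri k ℕ.+ suc a
      N≤tri+a = ℕₚ.≤-trans (ℕₚ.≤-reflexive (≡.trans (≡.sym a+k≡N) (ℕₚ.+-comm a k))) (ℕₚ.+-mono-≤ (n≤tri k) (ℕₚ.n≤1+n a))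

    -- Jacobi's triple product modulo b^N: the factor (b; b)_N strips the Gaussian binomials from
    -- `finiteTheta`.
    theta : ∀ d → poch 0 N * Π< N (λ i → 1# + d * b ^ suc i + b ^ suc i * b ^ suc i)
                ≈ Σ< (suc N) (λ k → dualSeq d k * b ^ tri k)
    theta d = begin
      poch 0 N * Π< N (λ i → 1# + d * b ^ suc i + b ^ suc i * b ^ suc i)
        ≈⟨ *-congˡ (finiteTheta d N N ℕₚ.≤-refl) ⟨
      poch 0 N * Σ< (suc N) (λ k → dualSeq d k * coef N k)
        ≈⟨ Σ<-*ˡ (suc N) (poch 0 N) _ ⟨
      Σ< (suc N) (λ k → poch 0 N * (dualSeq d k * coef N k))
        ≈⟨ Σ<-cong (suc N) (λ k k≤N → trans
             (solve 3 (λ p s c → p :* (s :* c) := s :* (p :* c)) refl (poch 0 N) (dualSeq d k) (coef N k))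
             (*-congˡ (poch-coef k (ℕₚ.≤-pred k≤N)))) ⟩
      Σ< (suc N) (λ k → dualSeq d k * b ^ tri k) ∎

    euler : poch 0 N ≈ pentagonal (suc N)
    euler = begin
      poch 0 N
        ≈⟨ solve 1 (λ p → p := con (+ 1) :* p :* con (+ 1)) refl (poch 0 N) ⟩
      shanksTerm N 0
        ≈⟨ Σ<-head N (λ s _ → trans (*-congˡ (high (ℕₚ.≤-trans (ℕₚ.m≤m+n N (s ℕ.* N)) (ℕₚ.m≤m+n _ _)))) (zeroʳ _)) ⟨
      Σ< (suc N) (shanksTerm N)
        ≈⟨ shanks N ⟩
      pentagonal N + ε N * b ^ (N ℕ.* N ℕ.+ tri N)
        -- The leftover term and a zero form the pair l = N, lengthening the sum to N + 1 so that it
        -- fits the later window.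
        ≈⟨ +-congˡ (+-identityʳ _) ⟨
      pentagonal N + (ε N * b ^ (N ℕ.* N ℕ.+ tri N) + 0#)
        ≈⟨ +-congˡ (+-congˡ (trans (*-congˡ (high
             (ℕₚ.≤-trans (ℕₚ.n≤1+n N) (ℕₚ.≤-trans (ℕₚ.m≤m+n (suc N) (N ℕ.* suc N)) (ℕₚ.m≤m+n _ (tri N)))))) (zeroʳ _))) ⟨
      pentagonal (suc N) ∎

-- Sums over finite windows of ℤ.

module BilateralSum (R : CommutativeRing 0ℓ 0ℓ) where

  open RingTools R
  open Exponents

  -- The sum of f over the window [-M, M), which is symmetric under ρ.
  S : ℕ → (ℤ → Carrier) → Carrier
  S M f = Σ< M (λ i → f (+ i) + f -[1+ i ])

  private
    pred-suc : ∀ i → -[1+ i ] ℤ.+ + 1 ≡ ℤ.- + i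
    pred-suc zero    = ≡.refl
    pred-suc (suc i) = ≡.refl

  -- On [-M, M) both |k| and |k + 1| are at most M; the substitutions by k and by k + 1 each need
  -- one of the bounds.
  S-cong : ∀ M {f g} → (∀ k → ∣ k ∣ ℕ.≤ M → ∣ k ℤ.+ + 1 ∣ ℕ.≤ M → f k ≈ g k) → S M f ≈ S M g
  S-cong M f≈g = Σ<-cong M λ i i<M → +-cong
    (f≈g (+ i) (ℕₚ.<⇒≤ i<M) (≡.subst (ℕ._≤ M) (ℕₚ.+-comm 1 i) i<M))
    (f≈g -[1+ i ] i<M (≡.subst (ℕ._≤ M) (≡.sym (≡.trans (≡.cong ∣_∣ (pred-suc i)) (ℤₚ.∣-i∣≡∣i∣ (+ i)))) (ℕₚ.<⇒≤ i<M)))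

  S-cong′ : ∀ M {f g} → (∀ k → f k ≈ g k) → S M f ≈ S M g
  S-cong′ M f≈g = S-cong M λ k _ _ → f≈g k

  S-+ : ∀ M f g → S M (λ k → f k + g k) ≈ S M f + S M g
  S-+ M f g = trans (Σ<-cong M λ i _ →
      solve 4 (λ a b c d → (a :+ b) :+ (c :+ d) := (a :+ c) :+ (b :+ d)) refl (f (+ i)) (g (+ i)) (f -[1+ i ]) (g -[1+ i ]))
    (Σ<-+ M _ _)

  S-*ˡ : ∀ M c f → S M (λ k → c * f k) ≈ c * S M f
  S-*ˡ M c f = trans (Σ<-cong M λ i _ → sym (distribˡ c (f (+ i)) (f -[1+ i ]))) (Σ<-*ˡ M c _)

  S-*ʳ : ∀ M c f → S M (λ k → f k * c) ≈ S M f * c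
  S-*ʳ M c f = trans (S-cong′ M λ k → *-comm (f k) c) (trans (S-*ˡ M c f) (*-comm c _))

  S-0 : ∀ M {f} → (∀ k → ∣ k ∣ ℕ.≤ M → ∣ k ℤ.+ + 1 ∣ ℕ.≤ M → f k ≈ 0#) → S M f ≈ 0#
  S-0 M f≈0 = trans (S-cong M f≈0) (trans (Σ<-cong M λ i _ → +-identityʳ 0#) (Σ<-0 M))

  S-product : ∀ M L f g → S M f * S L g ≈ S M (λ m → S L (λ n → f m * g n))
  S-product M L f g = sym (trans (S-cong′ M λ m → S-*ˡ L (f m) g) (S-*ʳ M (S L g) f))

  S-swap : ∀ M L (f : ℤ → ℤ → Carrier) → S M (λ m → S L (f m)) ≈ S L (λ n → S M (λ m → f m n))
  S-swap zero    L f = sym (S-0 L λ _ _ _ → refl)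
  S-swap (suc M) L f = begin
    S M (λ m → S L (f m)) + (S L (f (+ M)) + S L (f -[1+ M ]))
      ≈⟨ +-cong (S-swap M L f) (sym (S-+ L (f (+ M)) (f -[1+ M ]))) ⟩
    S L (λ n → S M (λ m → f m n)) + S L (λ n → f (+ M) n + f -[1+ M ] n)
      ≈⟨ S-+ L (λ n → S M (λ m → f m n)) (λ n → f (+ M) n + f -[1+ M ] n) ⟨
    S L (λ n → S (suc M) (λ m → f m n)) ∎

  S-reflect : ∀ M f → S M (λ k → f (ρ k)) ≈ S M f
  S-reflect M f = Σ<-cong M λ i _ → +-comm (f -[1+ i ]) (f (+ i))

  S-antisym : ∀ M f → (∀ k → f (ρ k) ≈ - f k) → S M f ≈ 0#
  S-antisym M f anti = trans (Σ<-cong M λ i _ → trans (+-congˡ (anti (+ i))) (-‿inverseʳ (f (+ i)))) (Σ<-0 M)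

  S-extend : ∀ M d f → (∀ k → M ℕ.≤ ∣ k ∣ → f k ≈ 0#) → S (d ℕ.+ M) f ≈ S M f
  S-extend M zero    f f≈0 = refl
  S-extend M (suc d) f f≈0 = begin
    S (d ℕ.+ M) f + (f (+ (d ℕ.+ M)) + f -[1+ d ℕ.+ M ])
      ≈⟨ +-cong (S-extend M d f f≈0)
           (+-cong (f≈0 _ (ℕₚ.m≤n+m M d)) (f≈0 _ (ℕₚ.≤-trans (ℕₚ.m≤n+m M d) (ℕₚ.n≤1+n _)))) ⟩
    S M f + (0# + 0#)  ≈⟨ +-congˡ (+-identityʳ 0#) ⟩
    S M f + 0#         ≈⟨ +-identityʳ _ ⟩
    S M f              ∎

  -- The shifted window loses -M and gains M.
  S-suc : ∀ M f → S M (λ k → f (k ℤ.+ + 1)) + f (ℤ.- + M) ≈ S M f + f (+ M)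
  S-suc zero    f = refl
  S-suc (suc M) f = begin
    (S M f⁺ + (f (+ M ℤ.+ + 1) + f (-[1+ M ] ℤ.+ + 1))) + f -[1+ M ]
      ≈⟨ +-congʳ (+-congˡ (+-cong (reflexive (≡.cong (λ j → f (+ j)) (ℕₚ.+-comm M 1))) (reflexive (≡.cong f (pred-suc M))))) ⟩
    (S M f⁺ + (f (+ suc M) + f (ℤ.- + M))) + f -[1+ M ]
      ≈⟨ solve 4 (λ s x y z → (s :+ (x :+ y)) :+ z := (s :+ y) :+ (x :+ z)) refl _ _ _ _ ⟩
    (S M f⁺ + f (ℤ.- + M)) + (f (+ suc M) + f -[1+ M ])
      ≈⟨ +-congʳ (S-suc M f) ⟩
    (S M f + f (+ M)) + (f (+ suc M) + f -[1+ M ])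
      ≈⟨ solve 4 (λ s x y z → (s :+ x) :+ (y :+ z) := (s :+ (x :+ z)) :+ y) refl _ _ _ _ ⟩
    (S M f + (f (+ M) + f -[1+ M ])) + f (+ suc M) ∎
    where
    f⁺ = λ k → f (k ℤ.+ + 1)

  private
    S-shift1 : ∀ M f → f (ℤ.- + M) ≈ 0# → f (+ M) ≈ 0# → S M (λ k → f (k ℤ.+ + 1)) ≈ S M f
    S-shift1 M f f-M≈0 fM≈0 = begin
      S M (λ k → f (k ℤ.+ + 1))                  ≈⟨ +-identityʳ _ ⟨
      S M (λ k → f (k ℤ.+ + 1)) + 0#             ≈⟨ +-congˡ f-M≈0 ⟨
      S M (λ k → f (k ℤ.+ + 1)) + f (ℤ.- + M)    ≈⟨ S-suc M f ⟩
      S M f + f (+ M)                            ≈⟨ +-congˡ fM≈0 ⟩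
      S M f + 0#                                 ≈⟨ +-identityʳ _ ⟩
      S M f                                      ∎

    ∣i∣≤∣i+j∣+∣j∣ : ∀ i j → ∣ i ∣ ℕ.≤ ∣ i ℤ.+ j ∣ ℕ.+ ∣ j ∣
    ∣i∣≤∣i+j∣+∣j∣ i j = ≡.subst (λ x → ∣ x ∣ ℕ.≤ ∣ i ℤ.+ j ∣ ℕ.+ ∣ j ∣) (cancel i j) (ℤₚ.∣i-j∣≤∣i∣+∣j∣ (i ℤ.+ j) j)
      where
      cancel : ∀ i j → (i ℤ.+ j) ℤ.- j ≡ i
      cancel = solveℤ-∀

  -- Each unit step exchanges one boundary value for another, so f has to vanish within distance |c|
  -- of the edges.
  S-shift : ∀ M c f → (∀ k → M ℕ.≤ ∣ k ∣ ℕ.+ ∣ c ∣ → f k ≈ 0#) → S M (λ k → f (k ℤ.+ c)) ≈ S M f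
  S-shift M (+ zero) f f≈0 = S-cong′ M λ k → reflexive (≡.cong f (ℤₚ.+-identityʳ k))
  S-shift M (+ suc n) f f≈0 = begin
    S M (λ k → f (k ℤ.+ + suc n))           ≈⟨ S-cong′ M (λ k → reflexive (≡.cong f (≡.sym (ℤₚ.+-assoc k (+ 1) (+ n))))) ⟩
    S M (λ k → f ((k ℤ.+ + 1) ℤ.+ + n))     ≈⟨ S-shift1 M (λ k → f (k ℤ.+ + n)) (f≈0 _ (edge (ℤ.- + M) (≡.sym (ℤₚ.∣-i∣≡∣i∣ (+ M))))) (f≈0 _ (edge (+ M) ≡.refl)) ⟩
    S M (λ k → f (k ℤ.+ + n))               ≈⟨ S-shift M (+ n) f (λ k M≤ → f≈0 k (ℕₚ.≤-trans M≤ (ℕₚ.+-monoʳ-≤ ∣ k ∣ (ℕₚ.n≤1+n n)))) ⟩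
    S M f                                   ∎
    where
    edge : ∀ m → M ≡ ∣ m ∣ → M ℕ.≤ ∣ m ℤ.+ + n ∣ ℕ.+ suc n
    edge m ≡.refl = ℕₚ.≤-trans (∣i∣≤∣i+j∣+∣j∣ m (+ n)) (ℕₚ.+-monoʳ-≤ ∣ m ℤ.+ + n ∣ (ℕₚ.n≤1+n n))
  S-shift M -[1+ n ] f f≈0 = begin
    S M (λ k → f (k ℤ.+ -[1+ n ]))
      ≈⟨ S-shift1 M (λ k → f (k ℤ.+ -[1+ n ])) (f≈0 _ (edge (ℤ.- + M) (≡.sym (ℤₚ.∣-i∣≡∣i∣ (+ M))))) (f≈0 _ (edge (+ M) ≡.refl)) ⟨
    S M (λ k → f ((k ℤ.+ + 1) ℤ.+ -[1+ n ]))
      ≈⟨ S-cong′ M (λ k → reflexive (≡.cong f (collect k (+ n)))) ⟩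
    S M (λ k → f (k ℤ.+ ℤ.- + n))
      ≈⟨ smaller n f≈0 ⟩
    S M f ∎
    where
    collect : ∀ k n → (k ℤ.+ + 1) ℤ.+ ℤ.- (+ 1 ℤ.+ n) ≡ k ℤ.+ ℤ.- n
    collect = solveℤ-∀
    edge : ∀ m → M ≡ ∣ m ∣ → M ℕ.≤ ∣ m ℤ.+ -[1+ n ] ∣ ℕ.+ suc n
    edge m ≡.refl = ∣i∣≤∣i+j∣+∣j∣ m -[1+ n ]
    smaller : ∀ n → (∀ k → M ℕ.≤ ∣ k ∣ ℕ.+ suc n → f k ≈ 0#) → S M (λ k → f (k ℤ.+ ℤ.- + n)) ≈ S M f
    smaller zero    f≈0 = S-shift M (+ 0) f (λ k M≤ → f≈0 k (ℕₚ.≤-trans M≤ (ℕₚ.+-monoʳ-≤ ∣ k ∣ z≤n)))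
    smaller (suc n) f≈0 = S-shift M -[1+ n ] f (λ k M≤ → f≈0 k (ℕₚ.≤-trans M≤ (ℕₚ.+-monoʳ-≤ ∣ k ∣ (ℕₚ.n≤1+n (suc n)))))

  -- The window [-3M, 3M) is the disjoint union of the triples 3w, 3w + 1, 3w + 2 with w in [-M, M),
  -- without overhang.
  S-triple : ∀ M f → S (M ℕ.* 3) f ≈ S M (λ w → (f (w ℤ.* + 3) + f (w ℤ.* + 3 ℤ.+ + 1)) + f (w ℤ.* + 3 ℤ.+ + 2))
  S-triple zero    f = refl
  S-triple (suc M) f = trans (+-congʳ (+-congʳ (+-congʳ (S-triple M f))))
    (trans (solve 7 (λ s a b c d e g → ((s :+ (a :+ b)) :+ (c :+ d)) :+ (e :+ g) := s :+ (((a :+ c) :+ e) :+ ((g :+ d) :+ b))) refl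
        _ (f (+ j)) (f -[1+ j ]) (f (+ suc j)) (f -[1+ suc j ]) (f (+ suc (suc j))) (f -[1+ suc (suc j) ]))
      (+-congˡ (+-cong (+-cong (+-cong (at (ℤₚ.pos-* M 3)) (at (≡.trans (≡.cong +_ (ℕₚ.+-comm 1 j)) (≡.cong (ℤ._+ + 1) (ℤₚ.pos-* M 3)))))
          (at (≡.trans (≡.cong +_ (ℕₚ.+-comm 2 j)) (≡.cong (ℤ._+ + 2) (ℤₚ.pos-* M 3))))) refl)))
    where
    j = M ℕ.* 3
    at : ∀ {k l} → k ≡ l → f k ≈ f l
    at = λ k≡l → reflexive (≡.cong f k≡l)

-- The theta series of f_2^5 / f_1^2.

module ThetaQuotient (R : CommutativeRing 0ℓ 0ℓ) (q : CommutativeRing.Carrier R) (N : ℕ)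
  (q^N≈0 : RingTools._≈_ R (RingTools._^_ R q N) (RingTools.0# R)) where

  open RingTools R
  open Exponents
  open BilateralSum R
  open QSeries R q

  open Nilpotent N q^N≈0

  M : ℕ
  M = suc N

  εℤ : ℤ → Carrier
  εℤ (+ n)    = ε n
  εℤ -[1+ n ] = ε (suc n)

  εℤ-suc : ∀ k → εℤ (k ℤ.+ + 1) ≈ - εℤ k
  εℤ-suc (+ n)          = reflexive (≡.cong ε (ℕₚ.+-comm n 1))
  εℤ-suc -[1+ zero ]    = sym (-‿involutive 1#)
  εℤ-suc -[1+ suc n ]   = sym (-‿involutive (ε (suc n)))

  εℤ-ρ : ∀ k → εℤ (ρ k) ≈ - εℤ k
  εℤ-ρ (+ n)    = refl
  εℤ-ρ -[1+ n ] = sym (-‿involutive (ε n))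

  εℤ-+ : ∀ i j → εℤ (i ℤ.+ j) ≈ εℤ i * εℤ j
  εℤ-+ i (+ zero) = trans (reflexive (≡.cong εℤ (ℤₚ.+-identityʳ i))) (sym (*-identityʳ _))
  εℤ-+ i (+ suc n) = begin
    εℤ (i ℤ.+ + suc n)             ≡⟨ ≡.cong εℤ (reassoc i (+ n)) ⟩
    εℤ ((i ℤ.+ + n) ℤ.+ + 1)       ≈⟨ εℤ-suc (i ℤ.+ + n) ⟩
    - εℤ (i ℤ.+ + n)               ≈⟨ -‿cong (εℤ-+ i (+ n)) ⟩
    - (εℤ i * ε n)                 ≈⟨ -‿distribʳ-* _ _ ⟩
    εℤ i * - ε n                   ∎
    where
    reassoc : ∀ i n → i ℤ.+ (+ 1 ℤ.+ n) ≡ (i ℤ.+ n) ℤ.+ + 1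
    reassoc = solveℤ-∀
  εℤ-+ i -[1+ n ] = begin
    εℤ (i ℤ.+ -[1+ n ])                     ≈⟨ -‿involutive _ ⟨
    - - εℤ (i ℤ.+ -[1+ n ])                 ≈⟨ -‿cong (εℤ-suc (i ℤ.+ -[1+ n ])) ⟨
    - εℤ ((i ℤ.+ -[1+ n ]) ℤ.+ + 1)         ≡⟨ ≡.cong (λ k → - εℤ k) (reassoc i (+ n)) ⟩
    - εℤ (i ℤ.+ ℤ.- + n)                    ≈⟨ -‿cong (previous n) ⟩
    - (εℤ i * ε n)                          ≈⟨ -‿distribʳ-* _ _ ⟩
    εℤ i * - ε n                            ∎
    where
    reassoc : ∀ i n → (i ℤ.+ ℤ.- (+ 1 ℤ.+ n)) ℤ.+ + 1 ≡ i ℤ.+ ℤ.- n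
    reassoc = solveℤ-∀
    previous : ∀ n → εℤ (i ℤ.+ ℤ.- + n) ≈ εℤ i * ε n
    previous zero    = εℤ-+ i (+ zero)
    previous (suc n) = εℤ-+ i -[1+ n ]

  thetaTerm : ℤ → Carrier
  thetaTerm w = εℤ w * ι (+ 3 ℤ.* w ℤ.+ + 1) * q ^ thetaExp w

  pentTerm : ℤ → Carrier
  pentTerm l = εℤ l * q ^ pentExp l

  jacobiTerm : ℤ → Carrier
  jacobiTerm n = εℤ n * ι (+ 2 ℤ.* n ℤ.+ + 1) * q ^ (2 ℕ.* triℤ n)

  gaussTerm : ℤ → Carrier
  gaussTerm m = q ^ triℤ m

  -- The summand of Jacobi's series times Gauss's in the coordinates n and t, after the weight
  -- change and without its factor 2.
  H : ℤ → ℤ → Carrier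
  H n t = εℤ n * ι t * q ^ latticeExp n t

  private
    far : ∀ k → M ℕ.≤ ∣ k ∣ → N ℕ.≤ triℤ k
    far k M≤k = ℕₚ.≤-pred (ℕₚ.≤-trans M≤k (∣k∣≤1+triℤ k))

    kill : ∀ {e} c → N ℕ.≤ e → c * q ^ e ≈ 0#
    kill c N≤e = trans (*-congˡ (high N≤e)) (zeroʳ c)

    H-far₁ : ∀ n t → M ℕ.≤ ∣ n ∣ → H n t ≈ 0#
    H-far₁ n t M≤n = kill _ (ℕₚ.≤-trans (far n M≤n) (ℕₚ.≤-trans (ℕₚ.m≤m+n (triℤ n) _) (ℕₚ.m≤m+n (2 ℕ.* triℤ n) _)))

    H-far₂ : ∀ n t → M ℕ.≤ ∣ t ℤ.- n ℤ.- + 1 ∣ → H n t ≈ 0#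
    H-far₂ n t M≤m = kill _ (ℕₚ.≤-trans (far (t ℤ.- n ℤ.- + 1) M≤m) (ℕₚ.m≤n+m _ (2 ℕ.* triℤ n)))

    -- The substitution t = m + n + 1. Widening to 3M first leaves room for the shift and gives a
    -- window independent of n, so that the two sums can be swapped.
    H-inner : ∀ n → ∣ n ℤ.+ + 1 ∣ ℕ.≤ M → S M (λ m → H n (m ℤ.+ (n ℤ.+ + 1))) ≈ S (M ℕ.* 3) (H n)
    H-inner n n+1≤M = begin
      S M h                 ≈⟨ S-extend M (M ℕ.+ M) h h-far ⟨
      S (M ℕ.+ M ℕ.+ M) h   ≡⟨ ≡.cong (λ L → S L h) (eq M) ⟩
      S (M ℕ.* 3) h         ≈⟨ S-shift (M ℕ.* 3) c (H n) H-far ⟩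
      S (M ℕ.* 3) (H n)     ∎
      where
      c = n ℤ.+ + 1
      h = λ m → H n (m ℤ.+ c)
      eq : ∀ M → M ℕ.+ M ℕ.+ M ≡ M ℕ.* 3
      eq = solve-∀
      cancel : ∀ m n → (m ℤ.+ (n ℤ.+ + 1)) ℤ.- n ℤ.- + 1 ≡ m
      cancel = solveℤ-∀
      h-far : ∀ m → M ℕ.≤ ∣ m ∣ → h m ≈ 0#
      h-far m M≤m = H-far₂ n (m ℤ.+ c) (≡.subst (λ k → M ℕ.≤ ∣ k ∣) (≡.sym (cancel m n)) M≤m)
      H-far : ∀ t → M ℕ.* 3 ℕ.≤ ∣ t ∣ ℕ.+ ∣ c ∣ → H n t ≈ 0#
      H-far t 3M≤ = H-far₂ n t (window-bound M n t n+1≤M 3M≤)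

    F : ℤ → Carrier
    F t = S M (λ n → H n t)

    -- Adding Σ (-1)^n (2m+1) … = 0 turns the weight 2n+1 into 2(n+m+1).
    product-H : S M jacobiTerm * S M gaussTerm ≈ S M (λ n → S M (λ m → ι (+ 2) * H n (m ℤ.+ (n ℤ.+ + 1))))
    product-H = begin
      S M jacobiTerm * S M gaussTerm
        ≈⟨ trans (sym (+-identityʳ _)) (+-congˡ (sym vanishing)) ⟩
      S M jacobiTerm * S M gaussTerm + S M z * S M y
        ≈⟨ +-cong (S-product M M jacobiTerm gaussTerm) (S-product M M z y) ⟩
      S M (λ n → S M (λ m → jacobiTerm n * gaussTerm m)) + S M (λ n → S M (λ m → z n * y m))
        ≈⟨ S-+ M (λ n → S M (λ m → jacobiTerm n * gaussTerm m)) (λ n → S M (λ m → z n * y m)) ⟨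
      S M (λ n → S M (λ m → jacobiTerm n * gaussTerm m) + S M (λ m → z n * y m))
        ≈⟨ S-cong′ M (λ n → trans (sym (S-+ M (λ m → jacobiTerm n * gaussTerm m) (λ m → z n * y m))) (S-cong′ M (termwise n))) ⟩
      S M (λ n → S M (λ m → ι (+ 2) * H n (m ℤ.+ (n ℤ.+ + 1)))) ∎
      where
      z y : ℤ → Carrier
      z n = εℤ n * q ^ (2 ℕ.* triℤ n)
      y m = ι (+ 2 ℤ.* m ℤ.+ + 1) * gaussTerm m
      triℤ-ρ : ∀ n → triℤ (ρ n) ≡ triℤ n
      triℤ-ρ (+ n)    = ≡.refl
      triℤ-ρ -[1+ n ] = ≡.refl
      vanishing : S M z * S M y ≈ 0#
      vanishing = trans (*-congʳ (S-antisym M z λ n →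
          trans (*-cong (εℤ-ρ n) (reflexive (≡.cong (λ e → q ^ (2 ℕ.* e)) (triℤ-ρ n)))) (sym (-‿distribˡ-* _ _))))
        (zeroˡ _)
      weight : ∀ n m → (+ 2 ℤ.* n ℤ.+ + 1) ℤ.+ (+ 2 ℤ.* m ℤ.+ + 1) ≡ + 2 ℤ.* (m ℤ.+ (n ℤ.+ + 1))
      weight = solveℤ-∀
      cancel : ∀ m n → (m ℤ.+ (n ℤ.+ + 1)) ℤ.- n ℤ.- + 1 ≡ m
      cancel = solveℤ-∀
      termwise : ∀ n m → jacobiTerm n * gaussTerm m + z n * y m ≈ ι (+ 2) * H n (m ℤ.+ (n ℤ.+ + 1))
      termwise n m = begin
        εℤ n * ι (+ 2 ℤ.* n ℤ.+ + 1) * x * gaussTerm m + (εℤ n * x) * (ι (+ 2 ℤ.* m ℤ.+ + 1) * gaussTerm m)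
          ≈⟨ solve 5 (λ e i j x g → e :* i :* x :* g :+ (e :* x) :* (j :* g) := e :* (i :+ j) :* (x :* g)) refl
               (εℤ n) (ι (+ 2 ℤ.* n ℤ.+ + 1)) (ι (+ 2 ℤ.* m ℤ.+ + 1)) x (gaussTerm m) ⟩
        εℤ n * (ι (+ 2 ℤ.* n ℤ.+ + 1) + ι (+ 2 ℤ.* m ℤ.+ + 1)) * (x * gaussTerm m)
          ≈⟨ *-cong (*-congˡ (trans (sym (ι-+ (+ 2 ℤ.* n ℤ.+ + 1) (+ 2 ℤ.* m ℤ.+ + 1)))
               (trans (reflexive (≡.cong ι (weight n m))) (ι-* (+ 2) t))))
               (^-merge q (2 ℕ.* triℤ n) (triℤ m) (≡.cong (λ k → 2 ℕ.* triℤ n ℕ.+ triℤ k) (≡.sym (cancel m n)))) ⟩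
        εℤ n * (ι (+ 2) * ι t) * q ^ latticeExp n t
          ≈⟨ solve 4 (λ e c i x → e :* (c :* i) :* x := c :* (e :* i :* x)) refl (εℤ n) (ι (+ 2)) (ι t) (q ^ latticeExp n t) ⟩
        ι (+ 2) * H n t ∎
        where
        x = q ^ (2 ℕ.* triℤ n)
        t = m ℤ.+ (n ℤ.+ + 1)

    -- The substitution n = l + w, with the window doubled to leave room for the shift by w.
    F-shift : ∀ w t → ∣ w ∣ ℕ.≤ M → F t ≈ S (M ℕ.+ M) (λ l → H (l ℤ.+ w) t)
    F-shift w t w≤M = begin
      F t                                     ≈⟨ S-extend M M (λ n → H n t) (λ n → H-far₁ n t) ⟨
      S (M ℕ.+ M) (λ n → H n t)               ≈⟨ S-shift (M ℕ.+ M) w (λ n → H n t) (λ n 2M≤ → H-far₁ n t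
                                                   (ℕₚ.+-cancelʳ-≤ M M ∣ n ∣ (ℕₚ.≤-trans 2M≤ (ℕₚ.+-monoʳ-≤ ∣ n ∣ w≤M)))) ⟨
      S (M ℕ.+ M) (λ l → H (l ℤ.+ w) t)       ∎

    -- Replacing l by -1-l keeps the exponent and the weight 3w but reverses the sign.
    F₀ : ∀ w → ∣ w ∣ ℕ.≤ M → F (w ℤ.* + 3) ≈ 0#
    F₀ w w≤M = trans (F-shift w (w ℤ.* + 3) w≤M) (S-antisym (M ℕ.+ M) (λ l → H (l ℤ.+ w) (w ℤ.* + 3)) λ l → begin
      εℤ (ρ l ℤ.+ w) * c * q ^ latticeExp (ρ l ℤ.+ w) (w ℤ.* + 3)
        ≈⟨ *-cong (*-congʳ (sign l)) (reflexive (≡.cong (q ^_) (latticeExp-ρ₀ w l))) ⟩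
      (- εℤ (l ℤ.+ w)) * c * q ^ latticeExp (l ℤ.+ w) (w ℤ.* + 3)
        ≈⟨ solve 3 (λ e c x → (:- e) :* c :* x := :- (e :* c :* x)) refl (εℤ (l ℤ.+ w)) c _ ⟩
      - H (l ℤ.+ w) (w ℤ.* + 3) ∎)
      where
      c = ι (w ℤ.* + 3)
      sign : ∀ l → εℤ (ρ l ℤ.+ w) ≈ - εℤ (l ℤ.+ w)
      sign l = begin
        εℤ (ρ l ℤ.+ w)         ≈⟨ εℤ-+ (ρ l) w ⟩
        εℤ (ρ l) * εℤ w        ≈⟨ *-congʳ (εℤ-ρ l) ⟩
        (- εℤ l) * εℤ w        ≈⟨ -‿distribˡ-* _ _ ⟨
        - (εℤ l * εℤ w)        ≈⟨ -‿cong (εℤ-+ l w) ⟨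
        - εℤ (l ℤ.+ w)         ∎

    F₁ : ∀ w → ∣ w ∣ ℕ.≤ M → F (w ℤ.* + 3 ℤ.+ + 1) ≈ thetaTerm w * S M pentTerm
    F₁ w w≤M = begin
      F (w ℤ.* + 3 ℤ.+ + 1)
        ≈⟨ F-shift w (w ℤ.* + 3 ℤ.+ + 1) w≤M ⟩
      S (M ℕ.+ M) (λ l → H (l ℤ.+ w) (w ℤ.* + 3 ℤ.+ + 1))
        ≈⟨ S-cong′ (M ℕ.+ M) factor ⟩
      S (M ℕ.+ M) (λ l → thetaTerm w * pentTerm l)
        ≈⟨ S-*ˡ (M ℕ.+ M) (thetaTerm w) pentTerm ⟩
      thetaTerm w * S (M ℕ.+ M) pentTerm
        ≈⟨ *-congˡ (S-extend M M pentTerm λ l M≤l → kill _ (ℕₚ.≤-trans (far l M≤l) (ℕₚ.m≤n+m _ (sqℤ l)))) ⟩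
      thetaTerm w * S M pentTerm ∎
      where
      factor : ∀ l → H (l ℤ.+ w) (w ℤ.* + 3 ℤ.+ + 1) ≈ thetaTerm w * pentTerm l
      factor l = begin
        εℤ (l ℤ.+ w) * ι (w ℤ.* + 3 ℤ.+ + 1) * q ^ latticeExp (l ℤ.+ w) (w ℤ.* + 3 ℤ.+ + 1)
          ≈⟨ *-cong (*-cong (εℤ-+ l w) (reflexive (≡.cong (λ k → ι (k ℤ.+ + 1)) (ℤₚ.*-comm w (+ 3)))))
               (trans (reflexive (≡.cong (q ^_) (latticeExp-split w l))) (^-homo-* q (thetaExp w) (pentExp l))) ⟩
        (εℤ l * εℤ w) * ι (+ 3 ℤ.* w ℤ.+ + 1) * (q ^ thetaExp w * q ^ pentExp l)
          ≈⟨ solve 5 (λ e f c x y → (e :* f) :* c :* (x :* y) := (f :* c :* x) :* (e :* y)) refl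
               (εℤ l) (εℤ w) (ι (+ 3 ℤ.* w ℤ.+ + 1)) (q ^ thetaExp w) (q ^ pentExp l) ⟩
        thetaTerm w * pentTerm l ∎

    -- Reflecting n changes the sign of (-1)^n, which compensates the sign of the weight t.
    F-neg : ∀ t → F (ℤ.- t) ≈ F t
    F-neg t = trans (sym (S-reflect M (λ n → H n (ℤ.- t)))) (S-cong′ M λ n → begin
      εℤ (ρ n) * ι (ℤ.- t) * q ^ latticeExp (ρ n) (ℤ.- t)
        ≈⟨ *-cong (*-cong (εℤ-ρ n) (ι-neg t)) (reflexive (≡.cong (q ^_) (latticeExp-ρ n t))) ⟩
      (- εℤ n) * (- ι t) * q ^ latticeExp n t
        ≈⟨ solve 3 (λ e c x → (:- e) :* (:- c) :* x := e :* c :* x) refl (εℤ n) (ι t) _ ⟩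
      H n t ∎)

    -- Under w ↦ -1-w the number 3w + 2 becomes -(3w + 1), and F is even.
    F₂ : S M (λ w → F (w ℤ.* + 3 ℤ.+ + 2)) ≈ S M (λ w → F (w ℤ.* + 3 ℤ.+ + 1))
    F₂ = trans (sym (S-reflect M (λ w → F (w ℤ.* + 3 ℤ.+ + 2)))) (S-cong′ M λ w → trans
      (reflexive (≡.cong F (≡.trans (≡.cong (λ k → k ℤ.* + 3 ℤ.+ + 2) (ρ≡ w)) (flip w)))) (F-neg (w ℤ.* + 3 ℤ.+ + 1)))
      where
      flip : ∀ w → ℤ.- (+ 1 ℤ.+ w) ℤ.* + 3 ℤ.+ + 2 ≡ ℤ.- (w ℤ.* + 3 ℤ.+ + 1)
      flip = solveℤ-∀

  -- In the factor 4, one 2 is that of the weight 2t and the other counts the residue classes ±1 of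
  -- t mod 3.
  lattice : S M jacobiTerm * S M gaussTerm ≈ ι (+ 4) * (S M thetaTerm * S M pentTerm)
  lattice = begin
    S M jacobiTerm * S M gaussTerm
      ≈⟨ product-H ⟩
    S M (λ n → S M (λ m → ι (+ 2) * H n (m ℤ.+ (n ℤ.+ + 1))))
      ≈⟨ S-cong M {g = λ n → ι (+ 2) * S (M ℕ.* 3) (H n)} (λ n _ n+1≤M → trans (S-*ˡ M (ι (+ 2)) (λ m → H n (m ℤ.+ (n ℤ.+ + 1)))) (*-congˡ (H-inner n n+1≤M))) ⟩
    S M (λ n → ι (+ 2) * S (M ℕ.* 3) (H n))
      ≈⟨ S-*ˡ M (ι (+ 2)) (λ n → S (M ℕ.* 3) (H n)) ⟩
    ι (+ 2) * S M (λ n → S (M ℕ.* 3) (H n))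
      ≈⟨ *-congˡ (S-swap M (M ℕ.* 3) H) ⟩
    ι (+ 2) * S (M ℕ.* 3) F
      ≈⟨ *-congˡ (S-triple M F) ⟩
    ι (+ 2) * S M (λ w → (F (w ℤ.* + 3) + F (w ℤ.* + 3 ℤ.+ + 1)) + F (w ℤ.* + 3 ℤ.+ + 2))
      ≈⟨ *-congˡ (S-+ M (λ w → F (w ℤ.* + 3) + F (w ℤ.* + 3 ℤ.+ + 1)) (λ w → F (w ℤ.* + 3 ℤ.+ + 2))) ⟩
    ι (+ 2) * (S M (λ w → F (w ℤ.* + 3) + F (w ℤ.* + 3 ℤ.+ + 1)) + S M (λ w → F (w ℤ.* + 3 ℤ.+ + 2)))
      ≈⟨ *-congˡ (+-cong (S-cong M {g = λ w → F (w ℤ.* + 3 ℤ.+ + 1)} λ w w≤M _ → trans (+-congʳ (F₀ w w≤M)) (+-identityˡ _)) F₂) ⟩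
    ι (+ 2) * (S M (λ w → F (w ℤ.* + 3 ℤ.+ + 1)) + S M (λ w → F (w ℤ.* + 3 ℤ.+ + 1)))
      ≈⟨ *-congˡ (+-cong final final) ⟩
    ι (+ 2) * (S M thetaTerm * S M pentTerm + S M thetaTerm * S M pentTerm)
      ≈⟨ solve 1 (λ x → con (+ 2) :* (x :+ x) := con (+ 4) :* x) refl (S M thetaTerm * S M pentTerm) ⟩
    ι (+ 4) * (S M thetaTerm * S M pentTerm) ∎
    where
    final : S M (λ w → F (w ℤ.* + 3 ℤ.+ + 1)) ≈ S M thetaTerm * S M pentTerm
    final = trans (S-cong M {g = λ w → thetaTerm w * S M pentTerm} λ w w≤M _ → F₁ w w≤M) (S-*ʳ M (S M pentTerm) thetaTerm)

  private

    module q² = QSeries R (q * q)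

    [q²]^N≈0 : (q * q) ^ N ≈ 0#
    [q²]^N≈0 = trans (^-distrib-* q q N) (trans (*-congʳ q^N≈0) (zeroˡ _))

  f₁ f₂ : Carrier
  f₁ = poch 0 N
  f₂ = q².poch 0 N

  private
    h J Ψ : Carrier
    h = Π< N (λ i → 1# + q ^ suc i)
    J = Σ< M (λ k → ε k * ι (+ 2 ℤ.* + k ℤ.+ + 1) * (q * q) ^ tri k)
    Ψ = Σ< M (λ k → q ^ tri k)

    -- d = -2 is z = 1, where all 2k + 1 powers of z equal 1.
    dualSeq-jacobi : ∀ k → dualSeq (ι -[1+ 1 ]) k ≈ ε k * ι (+ 2 ℤ.* + k ℤ.+ + 1)
    dualSeq-jacobi zero          = sym (*-identityʳ 1#)
    dualSeq-jacobi (suc zero)    = solve 0 (con -[1+ 1 ] :- con (+ 1) := :- con (+ 1) :* con (+ 3)) refl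
    dualSeq-jacobi (suc (suc k)) = begin
      ι -[1+ 1 ] * dualSeq (ι -[1+ 1 ]) (suc k) - dualSeq (ι -[1+ 1 ]) k
        ≈⟨ +-cong (*-congˡ (trans (dualSeq-jacobi (suc k)) (*-congˡ (grow (+ 1) (+ 2) (step₁ (+ k)))))) (-‿cong (dualSeq-jacobi k)) ⟩
      ι -[1+ 1 ] * ((- ε k) * (a + ι (+ 2))) - ε k * a
        ≈⟨ solve 2 (λ e a → con -[1+ 1 ] :* ((:- e) :* (a :+ con (+ 2))) :- e :* a := (:- (:- e)) :* (a :+ con (+ 4))) refl (ε k) a ⟩
      (- - ε k) * (a + ι (+ 4))
        ≈⟨ *-congˡ (grow (+ 2) (+ 4) (step₂ (+ k))) ⟨
      (- - ε k) * ι (+ 2 ℤ.* (+ 2 ℤ.+ + k) ℤ.+ + 1) ∎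
      where
      a = ι (+ 2 ℤ.* + k ℤ.+ + 1)
      step₁ : ∀ k → + 2 ℤ.* (+ 1 ℤ.+ k) ℤ.+ + 1 ≡ (+ 2 ℤ.* k ℤ.+ + 1) ℤ.+ + 2
      step₁ = solveℤ-∀
      step₂ : ∀ k → + 2 ℤ.* (+ 2 ℤ.+ k) ℤ.+ + 1 ≡ (+ 2 ℤ.* k ℤ.+ + 1) ℤ.+ + 4
      step₂ = solveℤ-∀
      grow : ∀ i c → + 2 ℤ.* (i ℤ.+ + k) ℤ.+ + 1 ≡ (+ 2 ℤ.* + k ℤ.+ + 1) ℤ.+ c → ι (+ 2 ℤ.* (i ℤ.+ + k) ℤ.+ + 1) ≈ a + ι c
      grow i c eq = trans (reflexive (≡.cong ι eq)) (ι-+ (+ 2 ℤ.* + k ℤ.+ + 1) c)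

    -- d = 2 is z = -1, where the alternating sum of the powers is (-1)^k and cancels the sign.
    dualSeq-gauss : ∀ k → dualSeq (ι (+ 2)) k ≈ 1#
    dualSeq-gauss zero          = refl
    dualSeq-gauss (suc zero)    = solve 0 (con (+ 2) :- con (+ 1) := con (+ 1)) refl
    dualSeq-gauss (suc (suc k)) = trans (+-cong (*-congˡ (dualSeq-gauss (suc k))) (-‿cong (dualSeq-gauss k)))
      (solve 0 (con (+ 2) :* con (+ 1) :- con (+ 1) := con (+ 1)) refl)

    jacobi : f₂ * (f₂ * f₂) ≈ J
    jacobi = begin
      f₂ * (f₂ * f₂)
        ≈⟨ *-congˡ (Π<-* N _ _) ⟨
      f₂ * Π< N (λ i → (1# - (q * q) ^ suc i) * (1# - (q * q) ^ suc i))
        ≈⟨ *-congˡ (Π<-cong N λ i _ → solve 1 (λ x → (con (+ 1) :- x) :* (con (+ 1) :- x)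
             := con (+ 1) :+ con -[1+ 1 ] :* x :+ x :* x) refl ((q * q) ^ suc i)) ⟩
      f₂ * Π< N (λ i → 1# + ι -[1+ 1 ] * (q * q) ^ suc i + (q * q) ^ suc i * (q * q) ^ suc i)
        ≈⟨ q².Nilpotent.theta N [q²]^N≈0 (ι -[1+ 1 ]) ⟩
      Σ< M (λ k → dualSeq (ι -[1+ 1 ]) k * (q * q) ^ tri k)
        ≈⟨ Σ<-cong M (λ k _ → *-congʳ (dualSeq-jacobi k)) ⟩
      J ∎

    -- Since f_1 h = f_2, the left side is f_2² / f_1 written without division.
    gauss-Ψ : f₁ * (h * h) ≈ Ψ
    gauss-Ψ = begin
      f₁ * (h * h)
        ≈⟨ *-congˡ (Π<-* N _ _) ⟨
      f₁ * Π< N (λ i → (1# + q ^ suc i) * (1# + q ^ suc i))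
        ≈⟨ *-congˡ (Π<-cong N λ i _ → solve 1 (λ x → (con (+ 1) :+ x) :* (con (+ 1) :+ x)
             := con (+ 1) :+ con (+ 2) :* x :+ x :* x) refl (q ^ suc i)) ⟩
      f₁ * Π< N (λ i → 1# + ι (+ 2) * q ^ suc i + q ^ suc i * q ^ suc i)
        ≈⟨ theta (ι (+ 2)) ⟩
      Σ< M (λ k → dualSeq (ι (+ 2)) k * q ^ tri k)
        ≈⟨ Σ<-cong M (λ k _ → trans (*-congʳ (dualSeq-gauss k)) (*-identityˡ _)) ⟩
      Ψ ∎

    f₁h≈f₂ : f₁ * h ≈ f₂
    f₁h≈f₂ = trans (sym (Π<-* N _ _)) (Π<-cong N λ i _ → trans
      (solve 1 (λ x → (con (+ 1) :- x) :* (con (+ 1) :+ x) := con (+ 1) :- x :* x) refl (q ^ suc i))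
      (+-congˡ (-‿cong (sym (^-distrib-* q q (suc i))))))

    -- The indices k and -1-k contribute equally: the sign and the odd weight both change sign.
    S-jacobi : S M jacobiTerm ≈ ι (+ 2) * J
    S-jacobi = trans (Σ<-cong M λ k _ → term k) (Σ<-*ˡ M (ι (+ 2)) _)
      where
      odd-neg : ∀ k → + 2 ℤ.* (ℤ.- (+ 1 ℤ.+ k)) ℤ.+ + 1 ≡ ℤ.- (+ 2 ℤ.* k ℤ.+ + 1)
      odd-neg = solveℤ-∀
      term : ∀ k → jacobiTerm (+ k) + jacobiTerm -[1+ k ] ≈ ι (+ 2) * (ε k * ι (+ 2 ℤ.* + k ℤ.+ + 1) * (q * q) ^ tri k)
      term k = begin
        ε k * a * x + (- ε k) * ι (+ 2 ℤ.* -[1+ k ] ℤ.+ + 1) * x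
          ≈⟨ +-congˡ (*-congʳ (*-congˡ (trans (reflexive (≡.cong ι (odd-neg (+ k)))) (ι-neg (+ 2 ℤ.* + k ℤ.+ + 1))))) ⟩
        ε k * a * x + (- ε k) * (- a) * x
          ≈⟨ solve 3 (λ e a x → e :* a :* x :+ (:- e) :* (:- a) :* x := con (+ 2) :* (e :* a :* x)) refl (ε k) a x ⟩
        ι (+ 2) * (ε k * a * x)
          ≈⟨ *-congˡ (*-congˡ (trans (^-distrib-* q q (tri k))
               (^-merge q (tri k) (tri k) (≡.cong (tri k ℕ.+_) (≡.sym (ℕₚ.+-identityʳ (tri k))))))) ⟨
        ι (+ 2) * (ε k * a * (q * q) ^ tri k) ∎
        where
        a = ι (+ 2 ℤ.* + k ℤ.+ + 1)
        x = q ^ (2 ℕ.* tri k)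

    S-gauss : S M gaussTerm ≈ ι (+ 2) * Ψ
    S-gauss = trans (Σ<-cong M λ k _ → solve 1 (λ x → x :+ x := con (+ 2) :* x) refl (q ^ tri k)) (Σ<-*ˡ M (ι (+ 2)) _)

  -- Both sides of `lattice` carry a factor 4, the left one from doubling two one-sided sums; c
  -- removes it. What remains is T f_1² = f_2³ (f_1 h)².
  theta-quotient : ∀ c → c * ι (+ 4) ≈ 1# → S M thetaTerm * (f₁ * f₁) ≈ f₂ * (f₂ * f₂) * (f₂ * f₂)
  theta-quotient c c4≈1 = begin
    T * (f₁ * f₁)
      ≈⟨ solve 2 (λ T f → T :* (f :* f) := con (+ 1) :* (T :* f) :* f) refl T f₁ ⟩
    1# * (T * f₁) * f₁
      ≈⟨ *-congʳ (*-congʳ c4≈1) ⟨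
    (c * ι (+ 4)) * (T * f₁) * f₁
      ≈⟨ *-congʳ (*-assoc _ _ _) ⟩
    c * (ι (+ 4) * (T * f₁)) * f₁
      ≈⟨ *-congʳ (*-congˡ (*-congˡ (*-congˡ euler))) ⟩
    c * (ι (+ 4) * (T * S M pentTerm)) * f₁
      ≈⟨ *-congʳ (*-congˡ (sym lattice)) ⟩
    c * (S M jacobiTerm * S M gaussTerm) * f₁
      ≈⟨ *-congʳ (*-congˡ (*-cong S-jacobi S-gauss)) ⟩
    c * ((ι (+ 2) * J) * (ι (+ 2) * Ψ)) * f₁
      ≈⟨ solve 4 (λ c J Ψ f → c :* ((con (+ 2) :* J) :* (con (+ 2) :* Ψ)) :* f := (c :* con (+ 4)) :* (J :* Ψ :* f)) refl c J Ψ f₁ ⟩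
    (c * ι (+ 4)) * (J * Ψ * f₁)
      ≈⟨ *-cong c4≈1 (*-congʳ (*-cong (sym jacobi) (sym gauss-Ψ))) ⟩
    1# * (f₂ * (f₂ * f₂) * (f₁ * (h * h)) * f₁)
      ≈⟨ solve 3 (λ f g h → con (+ 1) :* (g :* (f :* (h :* h)) :* f) := g :* ((f :* h) :* (f :* h))) refl f₁ (f₂ * (f₂ * f₂)) h ⟩
    f₂ * (f₂ * f₂) * ((f₁ * h) * (f₁ * h))
      ≈⟨ *-congˡ (*-cong f₁h≈f₂ f₁h≈f₂) ⟩
    f₂ * (f₂ * f₂) * (f₂ * f₂) ∎
    where
    T = S M thetaTerm

-- The generating function of coloured partitions.

module GeneratingFunction (R : CommutativeRing 0ℓ 0ℓ) where

  open RingTools R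

  -- `W vs` stands for the generating series of `ways` on the list `vs`; the two equations express
  -- it as the product of all 1 / (1 - X^v).
  module Parts (X : Carrier) (N : ℕ) (X^N≈0 : X ^ N ≈ 0#)
    (W : List ℕ → Carrier) (W-[] : W [] ≈ 1#)
    (W-∷ : ∀ v vs → 1 ℕ.≤ v → (1# - X ^ v) * W (v ∷ vs) ≈ W vs) where

    open import Defs using (isEven; colours; colouredParts)
    open Exponents
    open QSeries R X
    open Nilpotent N X^N≈0 using (high)
    open ThetaQuotient R X N X^N≈0

    W-replicate : ∀ c m vs → (1# - X ^ suc m) ^ c * W (replicate c (suc m) ++ vs) ≈ W vs
    W-replicate zero    m vs = *-identityˡ (W vs)
    W-replicate (suc c) m vs = begin
      (u * u ^ c) * W (suc m ∷ replicate c (suc m) ++ vs)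
        ≈⟨ solve 3 (λ u v w → (u :* v) :* w := v :* (u :* w)) refl u (u ^ c) (W (suc m ∷ replicate c (suc m) ++ vs)) ⟩
      u ^ c * (u * W (suc m ∷ replicate c (suc m) ++ vs))
        ≈⟨ *-congˡ (W-∷ (suc m) (replicate c (suc m) ++ vs) (s≤s z≤n)) ⟩
      u ^ c * W (replicate c (suc m) ++ vs)
        ≈⟨ W-replicate c m vs ⟩
      W vs ∎
      where u = 1# - X ^ suc m

    W-concatMap : ∀ (F h : ℕ → ℕ) n → Π< n (λ i → (1# - X ^ suc (h i)) ^ F (suc (h i)))
      * W (concatMap (λ m → replicate (F m) m) (map suc (applyUpTo h n))) ≈ 1#
    W-concatMap F h zero    = trans (*-identityˡ (W [])) W-[]
    W-concatMap F h (suc n) = begin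
      Π< (suc n) f * W (replicate (F (suc (h 0))) (suc (h 0)) ++ rest)
        ≈⟨ *-congʳ (Π<-head n f) ⟩
      (f 0 * Π< n (λ i → f (suc i))) * W (replicate (F (suc (h 0))) (suc (h 0)) ++ rest)
        ≈⟨ solve 3 (λ u v w → (u :* v) :* w := v :* (u :* w)) refl (f 0) (Π< n (λ i → f (suc i))) _ ⟩
      Π< n (λ i → f (suc i)) * (f 0 * W (replicate (F (suc (h 0))) (suc (h 0)) ++ rest))
        ≈⟨ *-congˡ (W-replicate (F (suc (h 0))) (h 0) rest) ⟩
      Π< n (λ i → f (suc i)) * W rest
        ≈⟨ W-concatMap F (λ i → h (suc i)) n ⟩
      1# ∎
      where
      f = λ i → (1# - X ^ suc (h i)) ^ F (suc (h i))
      rest = concatMap (λ m → replicate (F m) m) (map suc (applyUpTo (λ i → h (suc i)) n))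

    colouredProduct : ℕ → ℕ → ℕ → Carrier
    colouredProduct r s n = Π< n (λ i → (1# - X ^ suc i) ^ colours r s (suc i))

    colouredProduct-inverse : ∀ r s n → colouredProduct r s n * W (colouredParts r s n) ≈ 1#
    colouredProduct-inverse r s n = W-concatMap (colours r s) (λ i → i) n

    1-X^≈1 : ∀ {m} → N ℕ.≤ m → 1# - X ^ m ≈ 1#
    1-X^≈1 {m} N≤m = trans (+-congˡ (-‿cong (high N≤m)))
      (solve 0 (con (+ 1) :- con (+ 0) := con (+ 1)) refl)

    1^ : ∀ n → 1# ^ n ≈ 1#
    1^ zero    = refl
    1^ (suc n) = trans (*-identityˡ _) (1^ n)

    Π<-trim : ∀ d f → (∀ i → N ℕ.≤ i → f i ≈ 1#) → Π< (d ℕ.+ N) f ≈ Π< N f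
    Π<-trim zero    f f≈1 = refl
    Π<-trim (suc d) f f≈1 = trans (*-cong (Π<-trim d f f≈1) (f≈1 (d ℕ.+ N) (ℕₚ.m≤n+m N d))) (*-identityʳ _)

    private
      evenFactor : ℕ → ℕ → Carrier
      evenFactor d m = if isEven m then (1# - X ^ m) ^ d else 1#

      isEven-*2 : ∀ n → isEven (n ℕ.* 2) ≡ true
      isEven-*2 zero    = ≡.refl
      isEven-*2 (suc n) = isEven-*2 n

      isEven-suc*2 : ∀ n → isEven (suc (n ℕ.* 2)) ≡ false
      isEven-suc*2 zero    = ≡.refl
      isEven-suc*2 (suc n) = isEven-suc*2 n

      evenProduct-double : ∀ d n → Π< (n ℕ.* 2) (λ i → evenFactor d (suc i)) ≈ Π< n (λ i → (1# - X ^ (suc i ℕ.* 2)) ^ d)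
      evenProduct-double d zero    = refl
      evenProduct-double d (suc n) = *-cong
        (trans (*-cong (evenProduct-double d n)
            (reflexive (≡.cong (λ b → if b then (1# - X ^ suc (n ℕ.* 2)) ^ d else 1#) (isEven-suc*2 n))))
          (*-identityʳ _))
        (reflexive (≡.cong (λ b → if b then (1# - X ^ suc (suc (n ℕ.* 2))) ^ d else 1#) (isEven-*2 n)))

    [X²]^ : ∀ k → (X * X) ^ k ≈ X ^ (k ℕ.* 2)
    [X²]^ k = trans (^-distrib-* X X k) (^-merge X k k (double k))
      where
      double : ∀ k → k ℕ.+ k ≡ k ℕ.* 2
      double = solve-∀

    -- The product is first extended to 2N factors, the new ones being 1, so that its even indices
    -- are exactly 2, 4, ..., 2N.
    evenProduct : ∀ d → Π< N (λ i → evenFactor d (suc i)) ≈ f₂ ^ d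
    evenProduct d = begin
      Π< N (λ i → evenFactor d (suc i))           ≈⟨ Π<-trim N (λ i → evenFactor d (suc i)) (λ i N≤i → trivial (suc i) (ℕₚ.m≤n⇒m≤1+n N≤i)) ⟨
      Π< (N ℕ.+ N) (λ i → evenFactor d (suc i))   ≡⟨ ≡.cong (λ n → Π< n (λ i → evenFactor d (suc i))) (double N) ⟩
      Π< (N ℕ.* 2) (λ i → evenFactor d (suc i))   ≈⟨ evenProduct-double d N ⟩
      Π< N (λ i → (1# - X ^ (suc i ℕ.* 2)) ^ d)   ≈⟨ Π<-cong N (λ i _ → ^-congˡ d (+-congˡ (-‿cong ([X²]^ (suc i))))) ⟨
      Π< N (λ i → (1# - (X * X) ^ suc i) ^ d)     ≈⟨ Π<-^ N (λ i → 1# - (X * X) ^ suc i) d ⟩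
      f₂ ^ d                                      ∎
      where
      double : ∀ k → k ℕ.+ k ≡ k ℕ.* 2
      double = solve-∀
      trivial : ∀ m → N ℕ.≤ m → evenFactor d m ≈ 1#
      trivial m N≤m with isEven m
      ... | true  = trans (^-congˡ d (1-X^≈1 N≤m)) (1^ d)
      ... | false = refl

    -- Giving the even parts d further colours puts all parts into r + d colours.
    colouredProduct-f₂ : ∀ r d → colouredProduct r (r ℕ.+ d) N * f₂ ^ d ≈ f₁ ^ (r ℕ.+ d)
    colouredProduct-f₂ r d = begin
      colouredProduct r (r ℕ.+ d) N * f₂ ^ d
        ≈⟨ *-congˡ (evenProduct d) ⟨
      colouredProduct r (r ℕ.+ d) N * Π< N (λ i → evenFactor d (suc i))
        ≈⟨ Π<-* N (λ i → (1# - X ^ suc i) ^ colours r (r ℕ.+ d) (suc i)) (λ i → evenFactor d (suc i)) ⟨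
      Π< N (λ i → (1# - X ^ suc i) ^ colours r (r ℕ.+ d) (suc i) * evenFactor d (suc i))
        ≈⟨ Π<-cong N (λ i _ → combine (suc i)) ⟩
      Π< N (λ i → (1# - X ^ suc i) ^ (r ℕ.+ d))
        ≈⟨ Π<-^ N (λ i → 1# - X ^ suc i) (r ℕ.+ d) ⟩
      f₁ ^ (r ℕ.+ d) ∎
      where
      combine : ∀ m → (1# - X ^ m) ^ colours r (r ℕ.+ d) m * evenFactor d m ≈ (1# - X ^ m) ^ (r ℕ.+ d)
      combine m with isEven m
      ... | true  = sym (^-homo-* (1# - X ^ m) r d)
      ... | false = *-identityʳ _

    colouredProduct-extend : ∀ r s n → suc n ≡ N → colouredProduct r s n ≈ colouredProduct r s N
    colouredProduct-extend r s n ≡.refl =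
      sym (trans (*-congˡ (trans (^-congˡ (colours r s N) (1-X^≈1 ℕₚ.≤-refl)) (1^ (colours r s N)))) (*-identityʳ _))

    -- The known f_2^(s-r) / f_1^s with s = r + d, cross-multiplied. Truncating at N = n + 1 makes
    -- the missing factor for part N equal to 1.
    generatingFunction : ∀ r d n → suc n ≡ N → f₁ ^ (r ℕ.+ d) * W (colouredParts r (r ℕ.+ d) n) ≈ f₂ ^ d
    generatingFunction r d n 1+n≡N = begin
      f₁ ^ (r ℕ.+ d) * w
        ≈⟨ *-congʳ (colouredProduct-f₂ r d) ⟨
      colouredProduct r (r ℕ.+ d) N * f₂ ^ d * w
        ≈⟨ *-congʳ (*-congʳ (colouredProduct-extend r (r ℕ.+ d) n 1+n≡N)) ⟨
      colouredProduct r (r ℕ.+ d) n * f₂ ^ d * w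
        ≈⟨ solve 3 (λ c f w → c :* f :* w := (c :* w) :* f) refl (colouredProduct r (r ℕ.+ d) n) (f₂ ^ d) w ⟩
      colouredProduct r (r ℕ.+ d) n * w * f₂ ^ d
        ≈⟨ *-congʳ (colouredProduct-inverse r (r ℕ.+ d) n) ⟩
      1# * f₂ ^ d
        ≈⟨ *-identityˡ _ ⟩
      f₂ ^ d ∎
      where w = W (colouredParts r (r ℕ.+ d) n)

    -- The series of ordinary partitions: one colour for every part.
    f₁⁻¹ : Carrier
    f₁⁻¹ = W (colouredParts 1 1 N)

    f₁-inverse : f₁ * f₁⁻¹ ≈ 1#
    f₁-inverse = trans (*-congʳ (Π<-cong N λ i _ → trans (sym (*-identityʳ _)) (reflexive (≡.cong ((1# - X ^ suc i) ^_) (one (suc i))))))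
      (colouredProduct-inverse 1 1 N)
      where
      one : ∀ m → 1 ≡ colours 1 1 m
      one m with isEven m
      ... | true  = ≡.refl
      ... | false = ≡.refl

-- The p-th power map in characteristic p.

module Frobenius (R : CommutativeRing 0ℓ 0ℓ) where

  open RingTools R

  absorption : ∀ n k → suc k ℕ.* (suc n C suc k) ≡ suc n ℕ.* (n C k)
  absorption zero    zero    = ≡.refl
  absorption zero    (suc k) = ≡.trans (≡.cong (suc (suc k) ℕ.*_) (k>n⇒nCk≡0 {1} {suc (suc k)} (s≤s (s≤s z≤n))))
    (≡.trans (ℕₚ.*-zeroʳ (suc (suc k))) (≡.sym (≡.cong (1 ℕ.*_) (k>n⇒nCk≡0 {0} {suc k} (s≤s z≤n)))))
  absorption (suc n) zero    =
    ≡.trans (≡.cong (1 ℕ.*_) (nC1≡n (suc (suc n)))) (≡.trans (ℕₚ.*-identityˡ _) (≡.sym (ℕₚ.*-identityʳ _)))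
  absorption (suc n) (suc k) =
    ≡.trans (≡.cong (suc (suc k) ℕ.*_) (≡.sym (nCk+nC[k+1]≡[n+1]C[k+1] (suc n) (suc k))))
    (≡.trans (dist k a b)
    (≡.trans (≡.cong₂ (λ x y → x ℕ.+ a ℕ.+ y) (absorption n k) (absorption n (suc k)))
    (≡.trans (collect n (n C k) (n C suc k) a)
    (≡.trans (≡.cong (λ x → suc n ℕ.* x ℕ.+ a) (nCk+nC[k+1]≡[n+1]C[k+1] n k)) (ℕₚ.+-comm (suc n ℕ.* a) a)))))
    where
    a = suc n C suc k
    b = suc n C suc (suc k)
    dist : ∀ k a b → suc (suc k) ℕ.* (a ℕ.+ b) ≡ suc k ℕ.* a ℕ.+ a ℕ.+ suc (suc k) ℕ.* b
    dist = solve-∀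
    collect : ∀ n c d a → suc n ℕ.* c ℕ.+ a ℕ.+ suc n ℕ.* d ≡ suc n ℕ.* (c ℕ.+ d) ℕ.+ a
    collect = solve-∀

  -- By absorption p divides (k+1) C(p, k+1), and p cannot divide the smaller number k + 1.
  prime∣C : ∀ {p} → Prime p → ∀ k → suc k ℕ.< p → p ∣ p C suc k
  prime∣C {suc p} pr k k<p with euclidsLemma (suc k) (suc p C suc k) pr (divides (p C k) (≡.trans (absorption p k) (ℕₚ.*-comm (suc p) _)))
  ... | inj₁ p∣k = ⊥-elim (ℕₚ.<⇒≱ k<p (∣⇒≤ p∣k))
  ... | inj₂ p∣C = p∣C

  nat-* : ∀ m n → nat (m ℕ.* n) ≈ nat m * nat n
  nat-* zero    n = sym (zeroˡ _)
  nat-* (suc m) n = begin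
    nat (n ℕ.+ m ℕ.* n)         ≈⟨ nat-+ n (m ℕ.* n) ⟩
    nat n + nat (m ℕ.* n)       ≈⟨ +-cong (sym (*-identityˡ _)) (nat-* m n) ⟩
    1# * nat n + nat m * nat n  ≈⟨ distribʳ _ _ _ ⟨
    (1# + nat m) * nat n        ≈⟨ *-congʳ (nat-suc m) ⟨
    nat (suc m) * nat n         ∎

  binomial : ∀ y n → (1# + y) ^ n ≈ Σ< (suc n) (λ k → nat (n C k) * y ^ k)
  binomial y zero    = sym (trans (+-identityˡ _) (*-identityʳ _))
  binomial y (suc n) = begin
    (1# + y) * (1# + y) ^ n
      ≈⟨ *-congˡ (binomial y n) ⟩
    (1# + y) * B
      ≈⟨ solve 2 (λ y B → (con (+ 1) :+ y) :* B := (B :+ con (+ 0)) :+ y :* B) refl y B ⟩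
    (B + 0#) + y * B
      ≈⟨ +-congʳ (+-congˡ (trans (*-congʳ (reflexive (≡.cong nat (k>n⇒nCk≡0 (ℕₚ.n<1+n n))))) (zeroˡ _))) ⟨
    Σ< (suc (suc n)) (λ k → nat (n C k) * y ^ k) + y * B
      ≈⟨ pascal-sum (suc n) ⟨
    Σ< (suc (suc n)) (λ k → nat (suc n C k) * y ^ k) ∎
    where
    B = Σ< (suc n) (λ k → nat (n C k) * y ^ k)
    pascal-sum : ∀ K → Σ< (suc K) (λ k → nat (suc n C k) * y ^ k)
      ≈ Σ< (suc K) (λ k → nat (n C k) * y ^ k) + y * Σ< K (λ k → nat (n C k) * y ^ k)
    pascal-sum zero    = sym (trans (+-congˡ (zeroʳ y)) (+-identityʳ _))
    pascal-sum (suc K) = trans (+-cong (pascal-sum K) (*-congʳ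
        (trans (reflexive (≡.cong nat (≡.sym (nCk+nC[k+1]≡[n+1]C[k+1] n K)))) (nat-+ (n C K) (n C suc K)))))
      (solve 6 (λ s t y a b z → (s :+ y :* t) :+ (a :+ b) :* (y :* z) := (s :+ b :* (y :* z)) :+ y :* (t :+ a :* z)) refl
        (Σ< (suc K) (λ k → nat (n C k) * y ^ k)) (Σ< K (λ k → nat (n C k) * y ^ k)) y (nat (n C K)) (nat (n C suc K)) (y ^ K))

  nat-∣ : ∀ {p m} → nat p ≈ 0# → p ∣ m → nat m ≈ 0#
  nat-∣ {p} p≈0 (divides q ≡.refl) = trans (nat-* q p) (trans (*-congˡ p≈0) (zeroʳ _))

  -- Only the two outer binomial terms survive in characteristic p.
  freshman : ∀ {p} → Prime p → nat p ≈ 0# → ∀ y → (1# + y) ^ p ≈ 1# + y ^ p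
  freshman {zero}  pr _   y = ⊥-elim (ℕ.≢-nonZero⁻¹ 0 ⦃ prime⇒nonZero pr ⦄ ≡.refl)
  freshman {suc p} pr p≈0 y = trans (binomial y (suc p)) (+-cong
    (trans (Σ<-head p λ k k<p → trans (*-congʳ (nat-∣ p≈0 (prime∣C pr k (s≤s k<p)))) (zeroˡ _)) (*-identityʳ 1#))
    (trans (*-congʳ (reflexive (≡.cong nat (nCn≡1 (suc p))))) (*-identityˡ _)))

  neg-^-odd : ∀ x m → (- x) ^ suc (2 ℕ.* m) ≈ - (x ^ suc (2 ℕ.* m))
  neg-^-odd x m = begin
    - x * (- x) ^ (2 ℕ.* m)       ≈⟨ *-congˡ (^-assocʳ (- x) 2 m) ⟨
    - x * ((- x) ^ 2) ^ m         ≈⟨ *-congˡ (^-congˡ m (solve 1 (λ x → (:- x) :* ((:- x) :* con (+ 1)) := x :* (x :* con (+ 1))) refl x)) ⟩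
    - x * (x ^ 2) ^ m             ≈⟨ *-congˡ (^-assocʳ x 2 m) ⟩
    - x * x ^ (2 ℕ.* m)           ≈⟨ -‿distribˡ-* _ _ ⟨
    - (x * x ^ (2 ℕ.* m))         ∎

-- Vanishing of coefficients in a residue class.

module ResidueClasses (R : CommutativeRing 0ℓ 0ℓ) (X : CommutativeRing.Carrier R)
  (p : ℕ) .⦃ _ : NonZero p ⦄ (r : ℕ) where

  open RingTools R
  open import Defs using (QNR)
  open Exponents
  open Frobenius R

  private
    square-residue : ∀ w e → + e ≡ + 3 ℤ.* (w ℤ.* w) ℤ.+ + 2 ℤ.* w → e % p ≡ r →
      + sqℤ (+ 3 ℤ.* w ℤ.+ + 1) ≡ + (3 ℕ.* r ℕ.+ 1) ℤ.+ + 3 ℤ.* + (e / p) ℤ.* + p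
    square-residue w e e≡ e%p≡r = ≡.trans (sqℤ≡ (+ 3 ℤ.* w ℤ.+ + 1)) (≡.trans (expand w)
      (≡.trans (≡.cong (λ x → + 3 ℤ.* x ℤ.+ + 1) (≡.trans (≡.sym e≡) division))
      (≡.trans (collect (+ r) (+ (e / p)) (+ p)) (≡.cong (λ x → x ℤ.+ + 1 ℤ.+ + 3 ℤ.* + (e / p) ℤ.* + p) (≡.sym (ℤₚ.pos-* 3 r))))))
      where
      expand : ∀ w → (+ 3 ℤ.* w ℤ.+ + 1) ℤ.* (+ 3 ℤ.* w ℤ.+ + 1) ≡ + 3 ℤ.* (+ 3 ℤ.* (w ℤ.* w) ℤ.+ + 2 ℤ.* w) ℤ.+ + 1
      expand = solveℤ-∀
      collect : ∀ r d p → + 3 ℤ.* (r ℤ.+ d ℤ.* p) ℤ.+ + 1 ≡ (+ 3 ℤ.* r ℤ.+ + 1) ℤ.+ + 3 ℤ.* d ℤ.* p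
      collect = solveℤ-∀
      division : + e ≡ + r ℤ.+ + (e / p) ℤ.* + p
      division = ≡.trans (≡.cong +_ (≡.trans (m≡m%n+[m/n]*n e p) (≡.cong (ℕ._+ e / p ℕ.* p) e%p≡r)))
        (≡.cong (λ x → + r ℤ.+ x) (ℤₚ.pos-* (e / p) p))

  residue-obstruction : Prime p → QNR (3 ℕ.* r ℕ.+ 1) p ⊎ p ∣ (3 ℕ.* r ℕ.+ 1) →
    ∀ w → thetaExp w % p ≡ r → p ∣ ∣ + 3 ℤ.* w ℤ.+ + 1 ∣
  residue-obstruction pPrime cond w e%p≡r with cond | square-residue w (thetaExp w) (thetaExp≡ w) e%p≡r
  -- The forbidden square root is y = |3w + 1|, the definition of `QNR` ranging over natural
  -- numbers.
  ... | inj₁ (_ , nonresidue) | square = ⊥-elim (nonresidue ∣ u ∣ (ℤS.∣⇒∣ᵤ (ℤS.divides (+ 3 ℤ.* + (thetaExp w / p))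
          (≡.trans (≡.cong (ℤ._- + (3 ℕ.* r ℕ.+ 1)) square) (cancel (+ (3 ℕ.* r ℕ.+ 1)) (+ 3 ℤ.* + (thetaExp w / p) ℤ.* + p))))))
    where
    u = + 3 ℤ.* w ℤ.+ + 1
    cancel : ∀ a b → (a ℤ.+ b) ℤ.- a ≡ b
    cancel = solveℤ-∀
  ... | inj₂ (divides c 3r+1≡cp) | square with euclidsLemma (∣ + 3 ℤ.* w ℤ.+ + 1 ∣) (∣ + 3 ℤ.* w ℤ.+ + 1 ∣) pPrime
        (ℤS.∣⇒∣ᵤ {+ p} {+ sqℤ (+ 3 ℤ.* w ℤ.+ + 1)} (ℤS.divides (+ c ℤ.+ + 3 ℤ.* + (thetaExp w / p)) (≡.trans square
          (≡.trans (≡.cong (ℤ._+ + 3 ℤ.* + (thetaExp w / p) ℤ.* + p) (≡.trans (≡.cong +_ 3r+1≡cp) (ℤₚ.pos-* c p)))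
            (≡.sym (ℤₚ.*-distribʳ-+ (+ p) (+ c) (+ 3 ℤ.* + (thetaExp w / p))))))))
  ...   | inj₁ p∣u = p∣u
  ...   | inj₂ p∣u = p∣u

  ι-∣ : nat p ≈ 0# → ∀ i → p ∣ ∣ i ∣ → ι i ≈ 0#
  ι-∣ p≈0 i p∣i with ℤS.∣ᵤ⇒∣ {+ p} {i} p∣i
  ... | ℤS.divides c ≡.refl = trans (ι-* c (+ p)) (trans (*-congˡ p≈0) (zeroʳ (ι c)))

  odd-prime : Prime p → 5 ℕ.≤ p → ∃ λ m → p ≡ suc (2 ℕ.* m)
  odd-prime pPrime 5≤p with p % 2 | m≡m%n+[m/n]*n p 2 | m%n<n p 2
  ... | zero        | p≡ | _ with prime⇒irreducible pPrime (divides (p / 2) p≡)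
  ...   | inj₁ ()
  ...   | inj₂ 2≡p = ⊥-elim (ℕₚ.<⇒≢ (ℕₚ.≤-trans (s≤s (s≤s (s≤s z≤n))) 5≤p) 2≡p)
  odd-prime pPrime 5≤p | suc zero    | p≡ | _ = p / 2 , ≡.trans p≡ (≡.cong suc (ℕₚ.*-comm (p / 2) 2))
  odd-prime pPrime 5≤p | suc (suc _) | _  | s≤s (s≤s ())

  -- Axiomatises the series whose coefficients at the exponents ≡ r (mod p) vanish.
  record VanishingClass : Set₁ where
    field
      Good     : Carrier → Set
      resp     : ∀ {f g} → f ≈ g → Good f → Good g
      0-good   : Good 0#
      +-good   : ∀ {f g} → Good f → Good g → Good (f + g)
      neg-good : ∀ {f} → Good f → Good (- f)
      shift    : ∀ m {f} → Good f → Good (X ^ (m ℕ.* p) * f)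
      unshift  : ∀ m {f} → 1 ℕ.≤ m → Good ((1# - X ^ (m ℕ.* p)) * f) → Good f
      monomial : ∀ e → e % p ≢ r → Good (X ^ e)

  module Consequences (N : ℕ) (X^N≈0 : X ^ N ≈ 0#) (V : VanishingClass) (pPrime : Prime p) (5≤p : 5 ℕ.≤ p) (p≈0 : nat p ≈ 0#) where
    open VanishingClass V
    open BilateralSum R
    open ThetaQuotient R X N X^N≈0

    -- f_2^p has to be multiplied onto a good series, f_1^p cancelled from one; both closure
    -- properties pass to products and powers.
    Preserving Reflecting : Carrier → Set
    Preserving u = ∀ {f} → Good f → Good (u * f)
    Reflecting u = ∀ {f} → Good (u * f) → Good f

    Preserving-Π : ∀ n f → (∀ i → Preserving (f i)) → Preserving (Π< n f)
    Preserving-Π zero    f _ good = resp (sym (*-identityˡ _)) good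
    Preserving-Π (suc n) f P good = resp (sym (*-assoc _ _ _)) (Preserving-Π n f P (P n good))

    Reflecting-Π : ∀ n f → (∀ i → Reflecting (f i)) → Reflecting (Π< n f)
    Reflecting-Π zero    f _ good = resp (*-identityˡ _) good
    Reflecting-Π (suc n) f P good = P n (Reflecting-Π n f P (resp (*-assoc _ _ _) good))

    Preserving-^ : ∀ u n → Preserving u → Preserving (u ^ n)
    Preserving-^ u zero    _ good = resp (sym (*-identityˡ _)) good
    Preserving-^ u (suc n) P good = resp (sym (*-assoc _ _ _)) (P (Preserving-^ u n P good))

    Reflecting-^ : ∀ u n → Reflecting u → Reflecting (u ^ n)
    Reflecting-^ u zero    _ good = resp (*-identityˡ _) good
    Reflecting-^ u (suc n) P good = Reflecting-^ u n P (P (resp (*-assoc _ _ _) good))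

    private
      Preserving-nat : ∀ n → Preserving (nat n)
      Preserving-nat zero    good = resp (sym (zeroˡ _)) 0-good
      Preserving-nat (suc n) good = resp (sym (trans (*-congʳ (nat-suc n))
        (trans (distribʳ _ _ _) (+-congʳ (*-identityˡ _))))) (+-good good (Preserving-nat n good))

      Preserving-ι : ∀ i → Preserving (ι i)
      Preserving-ι (+ n)    good = Preserving-nat n good
      Preserving-ι -[1+ n ] good = resp (-‿distribˡ-* _ _) (neg-good (Preserving-nat (suc n) good))

      Preserving-ε : ∀ n → Preserving (ε n)
      Preserving-ε zero    good = resp (sym (*-identityˡ _)) good
      Preserving-ε (suc n) good = resp (-‿distribˡ-* _ _) (neg-good (Preserving-ε n good))

      Preserving-εℤ : ∀ i → Preserving (εℤ i)
      Preserving-εℤ (+ n)    = Preserving-ε n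
      Preserving-εℤ -[1+ n ] = Preserving-ε (suc n)

    -- An exponent in the class r forces the coefficient 3w + 1 to be 0 in the ring; any other
    -- exponent gives a good monomial.
    theta-good : QNR (3 ℕ.* r ℕ.+ 1) p ⊎ p ∣ (3 ℕ.* r ℕ.+ 1) → ∀ n → Good (S n thetaTerm)
    theta-good cond zero    = 0-good
    theta-good cond (suc n) = +-good (theta-good cond n) (+-good (term (+ n)) (term -[1+ n ]))
      where
      term : ∀ w → Good (thetaTerm w)
      term w with thetaExp w % p ℕₚ.≟ r
      ... | yes e%p≡r = resp (sym (trans (*-congʳ (trans (*-congˡ (ι-∣ p≈0 (+ 3 ℤ.* w ℤ.+ + 1) (residue-obstruction pPrime cond w e%p≡r)))
                          (zeroʳ _))) (zeroˡ _))) 0-good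
      ... | no  e%p≢r = resp (sym (*-assoc _ _ _))
                          (Preserving-εℤ w (Preserving-ι (+ 3 ℤ.* w ℤ.+ + 1) (monomial (thetaExp w) e%p≢r)))

    private
      m : ℕ
      m = let (m , _) = odd-prime pPrime 5≤p in m
      p≡ : p ≡ suc (2 ℕ.* m)
      p≡ = let (_ , eq) = odd-prime pPrime 5≤p in eq

      -- Oddness of p turns (-x)^p into -x^p.
      frobenius : ∀ x → (1# - x) ^ p ≈ 1# - x ^ p
      frobenius x = trans (freshman pPrime p≈0 (- x)) (+-congˡ (begin
        (- x) ^ p               ≡⟨ ≡.cong ((- x) ^_) p≡ ⟩
        (- x) ^ suc (2 ℕ.* m)   ≈⟨ neg-^-odd x m ⟩
        - (x ^ suc (2 ℕ.* m))   ≡⟨ ≡.cong (λ n → - (x ^ n)) p≡ ⟨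
        - (x ^ p)               ∎))

      f₁^p : f₁ ^ p ≈ Π< N (λ i → 1# - X ^ (suc i ℕ.* p))
      f₁^p = trans (sym (Π<-^ N (λ i → 1# - X ^ suc i) p))
        (Π<-cong N λ i _ → trans (frobenius (X ^ suc i)) (+-congˡ (-‿cong (^-assocʳ X (suc i) p))))

      f₂^p : f₂ ^ p ≈ Π< N (λ i → 1# - X ^ ((suc i ℕ.+ suc i) ℕ.* p))
      f₂^p = trans (sym (Π<-^ N (λ i → 1# - (X * X) ^ suc i) p))
        (Π<-cong N λ i _ → trans (frobenius ((X * X) ^ suc i)) (+-congˡ (-‿cong (trans
          (^-congˡ p (trans (^-distrib-* X X (suc i)) (^-merge X (suc i) (suc i) ≡.refl)))
          (^-assocʳ X (suc i ℕ.+ suc i) p)))))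

      -- With p = 2m + 1, the number m + 1 = (p + 1)/2 is the inverse of 2, and its square that of
      -- 4.
      quarter : Carrier
      quarter = nat (suc m) * nat (suc m)

      quarter-4 : quarter * ι (+ 4) ≈ 1#
      quarter-4 = begin
        h * h * ι (+ 4)           ≈⟨ solve 1 (λ h → h :* h :* con (+ 4) := (con (+ 2) :* h) :* (con (+ 2) :* h)) refl h ⟩
        (ι (+ 2) * h) * (ι (+ 2) * h)   ≈⟨ *-cong half half ⟩
        1# * 1#                   ≈⟨ *-identityˡ 1# ⟩
        1#                        ∎
        where
        h = nat (suc m)
        half : ι (+ 2) * h ≈ 1#
        half = begin
          nat 2 * nat (suc m)              ≈⟨ nat-* 2 (suc m) ⟨
          nat (suc (m ℕ.+ suc (m ℕ.+ 0)))  ≡⟨ ≡.cong (λ n → nat (suc n)) (≡.trans (ℕₚ.+-suc m (m ℕ.+ 0)) (≡.sym p≡)) ⟩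
          nat (suc p)                      ≈⟨ nat-suc p ⟩
          1# + nat p                       ≈⟨ +-congˡ p≈0 ⟩
          1# + 0#                          ≈⟨ +-identityʳ 1# ⟩
          1#                               ∎

      Reflecting-f₁^p : Reflecting (f₁ ^ p)
      Reflecting-f₁^p good = Reflecting-Π N (λ i → 1# - X ^ (suc i ℕ.* p)) (λ i → unshift (suc i) (s≤s z≤n)) (resp (*-congʳ f₁^p) good)

      Preserving-f₂^p : Preserving (f₂ ^ p)
      Preserving-f₂^p good = resp (*-congʳ (sym f₂^p)) (Preserving-Π N (λ i → 1# - X ^ ((suc i ℕ.+ suc i) ℕ.* p))
        (λ i {f} good → resp (solve 2 (λ x f → f :+ :- (x :* f) := (con (+ 1) :- x) :* f) refl (X ^ ((suc i ℕ.+ suc i) ℕ.* p)) f)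
          (+-good good (neg-good (shift (suc i ℕ.+ suc i) good)))) good)

    quotient-good : QNR (3 ℕ.* r ℕ.+ 1) p ⊎ p ∣ (3 ℕ.* r ℕ.+ 1) →
      ∀ k j {f₁⁻¹ f} → f₁ * f₁⁻¹ ≈ 1# → f₁ ^ (p ℕ.* k ℕ.+ (p ℕ.+ 2)) * f ≈ f₂ ^ (p ℕ.* j ℕ.+ 5) → Good f
    quotient-good cond k j {v} {f} f₁v≈1 eq = Reflecting-^ (f₁ ^ p) (suc k) Reflecting-f₁^p
      (resp (sym reduced) (Preserving-^ (f₂ ^ p) j Preserving-f₂^p (theta-good cond (suc N))))
      where
      T = S (suc N) thetaTerm
      F₁ = (f₁ ^ p) ^ suc k
      F₂ = (f₂ ^ p) ^ j
      exponent : p ℕ.* k ℕ.+ (p ℕ.+ 2) ≡ p ℕ.* suc k ℕ.+ 2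
      exponent = ≡.trans (≡.sym (ℕₚ.+-assoc (p ℕ.* k) p 2))
        (≡.cong (ℕ._+ 2) (≡.trans (ℕₚ.+-comm (p ℕ.* k) p) (≡.sym (ℕₚ.*-suc p k))))
      f₁^ : f₁ ^ (p ℕ.* k ℕ.+ (p ℕ.+ 2)) ≈ F₁ * (f₁ * f₁)
      f₁^ = begin
        f₁ ^ (p ℕ.* k ℕ.+ (p ℕ.+ 2))      ≡⟨ ≡.cong (f₁ ^_) exponent ⟩
        f₁ ^ (p ℕ.* suc k ℕ.+ 2)          ≈⟨ ^-homo-* f₁ (p ℕ.* suc k) 2 ⟩
        f₁ ^ (p ℕ.* suc k) * f₁ ^ 2       ≈⟨ *-cong (sym (^-assocʳ f₁ p (suc k))) (*-congˡ (*-identityʳ f₁)) ⟩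
        F₁ * (f₁ * f₁)                    ∎
      f₂^ : f₂ ^ (p ℕ.* j ℕ.+ 5) ≈ F₂ * (T * (f₁ * f₁))
      f₂^ = begin
        f₂ ^ (p ℕ.* j ℕ.+ 5)              ≈⟨ ^-homo-* f₂ (p ℕ.* j) 5 ⟩
        f₂ ^ (p ℕ.* j) * f₂ ^ 5           ≈⟨ *-cong (sym (^-assocʳ f₂ p j))
          (solve 1 (λ x → x :* (x :* (x :* (x :* (x :* con (+ 1))))) := x :* (x :* x) :* (x :* x)) refl f₂) ⟩
        F₂ * (f₂ * (f₂ * f₂) * (f₂ * f₂)) ≈⟨ *-congˡ (theta-quotient quarter quarter-4) ⟨
        F₂ * (T * (f₁ * f₁))              ∎
      reduced : F₁ * f ≈ F₂ * T
      reduced = begin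
        -- Inserting (f_1 v)² = 1 cancels the factor f_1² that both sides share.
        F₁ * f                                    ≈⟨ solve 2 (λ F f → F :* f := F :* f :* (con (+ 1) :* con (+ 1))) refl F₁ f ⟩
        F₁ * f * (1# * 1#)                        ≈⟨ *-congˡ (*-cong f₁v≈1 f₁v≈1) ⟨
        F₁ * f * ((f₁ * v) * (f₁ * v))
          ≈⟨ solve 4 (λ F f g v → F :* f :* ((g :* v) :* (g :* v)) := F :* (g :* g) :* f :* (v :* v)) refl F₁ f f₁ v ⟩
        F₁ * (f₁ * f₁) * f * (v * v)              ≈⟨ *-congʳ (*-congʳ f₁^) ⟨
        f₁ ^ (p ℕ.* k ℕ.+ (p ℕ.+ 2)) * f * (v * v) ≈⟨ *-congʳ (trans eq f₂^) ⟩
        F₂ * (T * (f₁ * f₁)) * (v * v)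
          ≈⟨ solve 4 (λ F T g v → F :* (T :* (g :* g)) :* (v :* v) := F :* T :* ((g :* v) :* (g :* v))) refl F₂ T f₁ v ⟩
        F₂ * T * ((f₁ * v) * (f₁ * v))            ≈⟨ *-congˡ (*-cong f₁v≈1 f₁v≈1) ⟩
        F₂ * T * (1# * 1#)                        ≈⟨ solve 2 (λ F T → F :* T :* (con (+ 1) :* con (+ 1)) := F :* T) refl F₂ T ⟩
        F₂ * T                                    ∎

-- Formal power series modulo X^N.

module PowerSeries (A : CommutativeRing 0ℓ 0ℓ) (N : ℕ) where

  open RingTools A

  Series : Set
  Series = ℕ → Carrier

  infix 4 _≋_
  -- Agreement below N is congruence modulo X^N; as a record it lets unification recover f and g.
  record _≋_ (f g : Series) : Set where
    constructor below
    field
      at : ∀ n → n ℕ.< N → f n ≈ g n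
  open _≋_ public

  tail : Series → Series
  tail f n = f (suc n)

  infixl 7 _⋆_
  -- The Cauchy product by f = f(0) + X · tail f, which makes the ring laws provable by induction on
  -- the coefficient.
  _⋆_ : Series → Series → Series
  (f ⋆ g) zero    = f 0 * g 0
  (f ⋆ g) (suc n) = f 0 * g (suc n) + (tail f ⋆ g) n

  𝟎 𝟏 : Series
  𝟎 n       = 0#
  𝟏 zero    = 1#
  𝟏 (suc n) = 0#

  private
    infixl 6 _⊕_
    _⊕_ : Series → Series → Series
    (f ⊕ g) n = f n + g n

    ⋆-cong : ∀ n {f f′ g g′} → (∀ i → i ℕ.≤ n → f i ≈ f′ i) → (∀ i → i ℕ.≤ n → g i ≈ g′ i) → (f ⋆ g) n ≈ (f′ ⋆ g′) n
    ⋆-cong zero    f≈ g≈ = *-cong (f≈ 0 z≤n) (g≈ 0 z≤n)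
    ⋆-cong (suc n) f≈ g≈ = +-cong (*-cong (f≈ 0 z≤n) (g≈ (suc n) ℕₚ.≤-refl))
      (⋆-cong n (λ i i≤n → f≈ (suc i) (s≤s i≤n)) (λ i i≤n → g≈ i (ℕₚ.m≤n⇒m≤1+n i≤n)))

    -- The mirror image of the defining recursion, peeling g instead of f; commutativity follows
    -- from the two.
    ⋆-sucʳ : ∀ n f g → (f ⋆ g) (suc n) ≈ f (suc n) * g 0 + (f ⋆ tail g) n
    ⋆-sucʳ zero    f g = +-comm _ _
    ⋆-sucʳ (suc n) f g = trans (+-congˡ (⋆-sucʳ n (tail f) g))
      (solve 3 (λ x y z → x :+ (y :+ z) := y :+ (x :+ z)) refl (f 0 * g (suc (suc n))) (f (suc (suc n)) * g 0) _)

    ⋆-comm : ∀ n f g → (f ⋆ g) n ≈ (g ⋆ f) n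
    ⋆-comm zero    f g = *-comm _ _
    ⋆-comm (suc n) f g = trans (+-cong (*-comm _ _) (⋆-comm n (tail f) g)) (sym (⋆-sucʳ n g f))

    ⋆-distribʳ : ∀ n f g h → ((f ⊕ g) ⋆ h) n ≈ (f ⋆ h) n + (g ⋆ h) n
    ⋆-distribʳ zero    f g h = distribʳ _ _ _
    ⋆-distribʳ (suc n) f g h = trans (+-cong (distribʳ _ _ _) (⋆-distribʳ n (tail f) (tail g) h))
      (solve 4 (λ a b c d → (a :+ b) :+ (c :+ d) := (a :+ c) :+ (b :+ d)) refl _ _ _ _)

    ⋆-scale : ∀ n c f h → ((λ i → c * f i) ⋆ h) n ≈ c * (f ⋆ h) n
    ⋆-scale zero    c f h = *-assoc _ _ _
    ⋆-scale (suc n) c f h = trans (+-cong (*-assoc _ _ _) (⋆-scale n c (tail f) h)) (sym (distribˡ _ _ _))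

    ⋆-assoc : ∀ n f g h → ((f ⋆ g) ⋆ h) n ≈ (f ⋆ (g ⋆ h)) n
    ⋆-assoc zero    f g h = *-assoc _ _ _
    ⋆-assoc (suc n) f g h = begin
      f 0 * g 0 * h (suc n) + (tail (f ⋆ g) ⋆ h) n
        ≈⟨ +-congˡ (⋆-distribʳ n (λ i → f 0 * g (suc i)) (tail f ⋆ g) h) ⟩
      f 0 * g 0 * h (suc n) + (((λ i → f 0 * g (suc i)) ⋆ h) n + ((tail f ⋆ g) ⋆ h) n)
        ≈⟨ +-congˡ (+-cong (⋆-scale n (f 0) (tail g) h) (⋆-assoc n (tail f) g h)) ⟩
      f 0 * g 0 * h (suc n) + (f 0 * (tail g ⋆ h) n + (tail f ⋆ (g ⋆ h)) n)
        ≈⟨ solve 5 (λ a b c d e → a :* b :* c :+ (a :* d :+ e) := a :* (b :* c :+ d) :+ e) refl (f 0) (g 0) (h (suc n)) _ _ ⟩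
      f 0 * (g 0 * h (suc n) + (tail g ⋆ h) n) + (tail f ⋆ (g ⋆ h)) n ∎

    𝟎-⋆ : ∀ n g → (𝟎 ⋆ g) n ≈ 0#
    𝟎-⋆ zero    g = zeroˡ _
    𝟎-⋆ (suc n) g = trans (+-cong (zeroˡ _) (𝟎-⋆ n g)) (+-identityʳ 0#)

    𝟏-⋆ : ∀ n g → (𝟏 ⋆ g) n ≈ g n
    𝟏-⋆ zero    g = *-identityˡ _
    𝟏-⋆ (suc n) g = trans (+-cong (*-identityˡ _) (𝟎-⋆ n g)) (+-identityʳ _)

    pointwise : ∀ {f g} → (∀ n → f n ≈ g n) → f ≋ g
    pointwise f≈g = below λ n _ → f≈g n

  ring[[X]] : CommutativeRing 0ℓ 0ℓ
  ring[[X]] = record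
    { Carrier = Series ; _≈_ = _≋_ ; _+_ = _⊕_ ; _*_ = _⋆_ ; -_ = λ f n → - f n ; 0# = 𝟎 ; 1# = 𝟏
    ; isCommutativeRing = record
      { isRing = record
        { +-isAbelianGroup = record
          { isGroup = record
            { isMonoid = record
              { isSemigroup = record
                { isMagma = record
                  { isEquivalence = record
                    { refl  = pointwise λ _ → refl
                    ; sym   = λ f≋g → below λ n n<N → sym (at f≋g n n<N)
                    ; trans = λ f≋g g≋h → below λ n n<N → trans (at f≋g n n<N) (at g≋h n n<N) }
                  ; ∙-cong = λ f≋ g≋ → below λ n n<N → +-cong (at f≋ n n<N) (at g≋ n n<N) }
                ; assoc = λ f g h → pointwise λ n → +-assoc _ _ _ }
              ; identity = (λ f → pointwise λ n → +-identityˡ _) , (λ f → pointwise λ n → +-identityʳ _) }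
            ; inverse = (λ f → pointwise λ n → -‿inverseˡ _) , (λ f → pointwise λ n → -‿inverseʳ _)
            ; ⁻¹-cong = λ f≋ → below λ n n<N → -‿cong (at f≋ n n<N) }
          ; comm = λ f g → pointwise λ n → +-comm _ _ }
        ; *-cong = λ f≋ g≋ → below λ n n<N → ⋆-cong n
            (λ i i≤n → at f≋ i (ℕₚ.≤-<-trans i≤n n<N)) (λ i i≤n → at g≋ i (ℕₚ.≤-<-trans i≤n n<N))
        ; *-assoc = λ f g h → pointwise λ n → ⋆-assoc n f g h
        ; *-identity = (λ f → pointwise λ n → 𝟏-⋆ n f) , (λ f → pointwise λ n → trans (⋆-comm n f 𝟏) (𝟏-⋆ n f))
        ; distrib = (λ f g h → pointwise λ n → trans (⋆-comm n f (g ⊕ h))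
                       (trans (⋆-distribʳ n g h f) (+-cong (⋆-comm n g f) (⋆-comm n h f))))
                  , (λ f g h → pointwise λ n → ⋆-distribʳ n g h f) }
      ; *-comm = λ f g → pointwise λ n → ⋆-comm n f g } }

  X : Series
  X zero    = 0#
  X (suc n) = 𝟏 n

  open import Algebra.Properties.CommutativeSemiring.Exp (CommutativeRing.commutativeSemiring ring[[X]]) using () renaming (_^_ to _^⋆_)

  X-⋆-zero : ∀ f → (X ⋆ f) 0 ≈ 0#
  X-⋆-zero f = zeroˡ _

  X-⋆-suc : ∀ f n → (X ⋆ f) (suc n) ≈ f n
  X-⋆-suc f n = trans (+-cong (zeroˡ _) (𝟏-⋆ n f)) (+-identityˡ _)

  X^-⋆-< : ∀ m f n → n ℕ.< m → (X ^⋆ m ⋆ f) n ≈ 0#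
  X^-⋆-< (suc m) f zero    _         = trans (⋆-assoc 0 X (X ^⋆ m) f) (X-⋆-zero (X ^⋆ m ⋆ f))
  X^-⋆-< (suc m) f (suc n) (s≤s n<m) =
    trans (⋆-assoc (suc n) X (X ^⋆ m) f) (trans (X-⋆-suc (X ^⋆ m ⋆ f) n) (X^-⋆-< m f n n<m))

  X^-⋆-+ : ∀ m f n → (X ^⋆ m ⋆ f) (m ℕ.+ n) ≈ f n
  X^-⋆-+ zero    f n = 𝟏-⋆ n f
  X^-⋆-+ (suc m) f n =
    trans (⋆-assoc (suc m ℕ.+ n) X (X ^⋆ m) f) (trans (X-⋆-suc (X ^⋆ m ⋆ f) (m ℕ.+ n)) (X^-⋆-+ m f n))

  X^-coeff : ∀ e n → n ≢ e → (X ^⋆ e) n ≈ 0#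
  X^-coeff zero    zero    n≢e = ⊥-elim (n≢e ≡.refl)
  X^-coeff zero    (suc n) n≢e = refl
  X^-coeff (suc e) zero    n≢e = X-⋆-zero (X ^⋆ e)
  X^-coeff (suc e) (suc n) n≢e = trans (X-⋆-suc (X ^⋆ e) n) (X^-coeff e n (λ n≡e → n≢e (≡.cong suc n≡e)))

  X^N≋0 : (X ^⋆ N) ≋ 𝟎
  X^N≋0 = below λ n n<N → X^-coeff N n (ℕₚ.<⇒≢ n<N)

-- Integers modulo p.

infix 4 _≡_[mod_]
-- The explicit quotient reduces compatibility with the operations to polynomial identities.
record _≡_[mod_] (a b : ℤ) (p : ℕ) : Set where
  constructor differ
  field
    quotient : ℤ
    equality : a ≡ b ℤ.+ quotient ℤ.* + p

module _ (p : ℕ) where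

  private
    _~_ : ℤ → ℤ → Set
    a ~ b = a ≡ b [mod p ]

    ≡⇒~ : ∀ {a b} → a ≡ b → a ~ b
    ≡⇒~ {b = b} ≡.refl = differ (+ 0) (≡.sym (ℤₚ.+-identityʳ b))

    ~-sym : ∀ {a b} → a ~ b → b ~ a
    ~-sym {b = b} (differ c ≡.refl) = differ (ℤ.- c) (eq b c (+ p))
      where
      eq : ∀ b c p → b ≡ (b ℤ.+ c ℤ.* p) ℤ.+ ℤ.- c ℤ.* p
      eq = solveℤ-∀

    ~-trans : ∀ {a b c} → a ~ b → b ~ c → a ~ c
    ~-trans {c = c} (differ x ≡.refl) (differ y ≡.refl) = differ (y ℤ.+ x) (eq c x y (+ p))
      where
      eq : ∀ c x y p → (c ℤ.+ y ℤ.* p) ℤ.+ x ℤ.* p ≡ c ℤ.+ (y ℤ.+ x) ℤ.* p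
      eq = solveℤ-∀

    ~-+ : ∀ {a b c d} → a ~ b → c ~ d → (a ℤ.+ c) ~ (b ℤ.+ d)
    ~-+ {b = b} {d = d} (differ x ≡.refl) (differ y ≡.refl) = differ (x ℤ.+ y) (eq b d x y (+ p))
      where
      eq : ∀ b d x y p → (b ℤ.+ x ℤ.* p) ℤ.+ (d ℤ.+ y ℤ.* p) ≡ (b ℤ.+ d) ℤ.+ (x ℤ.+ y) ℤ.* p
      eq = solveℤ-∀

    ~-* : ∀ {a b c d} → a ~ b → c ~ d → (a ℤ.* c) ~ (b ℤ.* d)
    ~-* {b = b} {d = d} (differ x ≡.refl) (differ y ≡.refl) =
      differ (b ℤ.* y ℤ.+ x ℤ.* d ℤ.+ x ℤ.* y ℤ.* + p) (eq b d x y (+ p))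
      where
      eq : ∀ b d x y p → (b ℤ.+ x ℤ.* p) ℤ.* (d ℤ.+ y ℤ.* p) ≡ b ℤ.* d ℤ.+ (b ℤ.* y ℤ.+ x ℤ.* d ℤ.+ x ℤ.* y ℤ.* p) ℤ.* p
      eq = solveℤ-∀

    ~-neg : ∀ {a b} → a ~ b → (ℤ.- a) ~ (ℤ.- b)
    ~-neg {b = b} (differ x ≡.refl) = differ (ℤ.- x) (eq b x (+ p))
      where
      eq : ∀ b x p → ℤ.- (b ℤ.+ x ℤ.* p) ≡ ℤ.- b ℤ.+ ℤ.- x ℤ.* p
      eq = solveℤ-∀

  ℤ/ : CommutativeRing 0ℓ 0ℓ
  ℤ/ = record
    { Carrier = ℤ ; _≈_ = _~_ ; _+_ = ℤ._+_ ; _*_ = ℤ._*_ ; -_ = ℤ.-_ ; 0# = + 0 ; 1# = + 1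
    ; isCommutativeRing = record
      { isRing = record
        { +-isAbelianGroup = record
          { isGroup = record
            { isMonoid = record
              { isSemigroup = record
                { isMagma = record
                  { isEquivalence = record { refl = ≡⇒~ ≡.refl ; sym = ~-sym ; trans = ~-trans }
                  ; ∙-cong = ~-+ }
                ; assoc = λ a b c → ≡⇒~ (ℤₚ.+-assoc a b c) }
              ; identity = (λ a → ≡⇒~ (ℤₚ.+-identityˡ a)) , (λ a → ≡⇒~ (ℤₚ.+-identityʳ a)) }
            ; inverse = (λ a → ≡⇒~ (ℤₚ.+-inverseˡ a)) , (λ a → ≡⇒~ (ℤₚ.+-inverseʳ a))
            ; ⁻¹-cong = ~-neg }
          ; comm = λ a b → ≡⇒~ (ℤₚ.+-comm a b) }
        ; *-cong = ~-*
        ; *-assoc = λ a b c → ≡⇒~ (ℤₚ.*-assoc a b c)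
        ; *-identity = (λ a → ≡⇒~ (ℤₚ.*-identityˡ a)) , (λ a → ≡⇒~ (ℤₚ.*-identityʳ a))
        ; distrib = (λ a b c → ≡⇒~ (ℤₚ.*-distribˡ-+ a b c)) , (λ a b c → ≡⇒~ (ℤₚ.*-distribʳ-+ a b c)) }
      ; *-comm = λ a b → ≡⇒~ (ℤₚ.*-comm a b) } }

open import Defs
open import Data.Nat using (ℕ; _+_; _*_; _∸_; _≤_)
open import Data.Nat.Divisibility using (_∣_)
open import Data.Nat.Primality using (Prime)
open import Data.Sum using (_⊎_)
open Ways

-- Partition series modulo p and X^N, and the congruence.

module SeriesMod (p : ℕ) ⦃ _ : NonZero p ⦄ (N : ℕ) where
  open PowerSeries (ℤ/ p) N
  private
    module A = RingTools (ℤ/ p)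
    module R = RingTools ring[[X]]

  W : List ℕ → Series
  W vs n = + ways n vs

  W-[] : W [] ≋ 𝟏
  W-[] = below λ { zero _ → A.refl ; (suc n) _ → A.refl }

  1-x-* : ∀ x f → (R.1# R.- x) R.* f ≋ f R.- x R.* f
  1-x-* = R.solve 2 (λ x f → (R.con (+ 1) R.:- x) R.:* f R.:= f R.:- x R.:* f) R.refl

  -- Coefficientwise this is the recurrence for `ways`: below v the subtracted series is 0, from v
  -- on it is the series moved by v.
  W-∷ : ∀ v vs → 1 ℕ.≤ v → (R.1# R.- X R.^ v) R.* W (v ∷ vs) ≋ W vs
  W-∷ v vs 1≤v = R.trans (1-x-* (X R.^ v) (W (v ∷ vs))) (below λ n _ → coefficient n)
    where
    coefficient : ∀ n → (W (v ∷ vs) R.- X R.^ v R.* W (v ∷ vs)) n A.≈ W vs n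
    coefficient n with n ℕₚ.<? v
    ... | yes n<v = A.trans (A.+-cong (A.reflexive (≡.cong +_ (ways-< n v vs n<v))) (A.-‿cong (X^-⋆-< v (W (v ∷ vs)) n n<v)))
                      (A.+-identityʳ (W vs n))
    ... | no n≮v = ≡.subst (λ n → (W (v ∷ vs) R.- X R.^ v R.* W (v ∷ vs)) n A.≈ W vs n) (ℕₚ.m+[n∸m]≡n (ℕₚ.≮⇒≥ n≮v))
      (A.trans (A.+-cong (A.reflexive (≡.cong +_ (ways-+ m v vs 1≤v))) (A.-‿cong (X^-⋆-+ v (W (v ∷ vs)) m)))
        (A.reflexive (cancel (+ ways (v ℕ.+ m) vs) (+ ways m (v ∷ vs)))))
      where
      m = n ∸ v
      cancel : ∀ x y → (x ℤ.+ y) ℤ.- y ≡ x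
      cancel = solveℤ-∀

  p≈0 : R.nat p ≋ 𝟎
  p≈0 = below λ n _ → A.trans (A.reflexive (≡.trans (coefficient p n) (ℤₚ.*-comm (+ p) (𝟏 n))))
                        (differ (𝟏 n) (≡.sym (ℤₚ.+-identityˡ (𝟏 n ℤ.* + p))))
    where
    coefficient : ∀ m n → R.nat m n ≡ + m ℤ.* 𝟏 n
    coefficient zero          n = ≡.refl
    coefficient (suc zero)    n = ≡.sym (ℤₚ.*-identityˡ (𝟏 n))
    coefficient (suc (suc m)) n =
      ≡.trans (≡.cong (λ x → 𝟏 n ℤ.+ x) (coefficient (suc m) n)) (≡.sym (ℤₚ.suc-* (+ suc m) (𝟏 n)))

  module _ (r : ℕ) where
    Good : Series → Set
    Good f = ∀ n → n ℕ.< N → n % p ≡ r → f n A.≈ A.0#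

    private
      drop-% : ∀ m n → (m * p + n) % p ≡ r → n % p ≡ r
      drop-% m n eq = ≡.trans (≡.sym ([m+kn]%n≡m%n n m p)) (≡.trans (≡.cong (_% p) (ℕₚ.+-comm n (m * p))) eq)

    good-shift : ∀ m {f} → Good f → Good (X R.^ (m * p) R.* f)
    good-shift m {f} good n n<N n%p≡r with n ℕₚ.<? m * p
    ... | yes n<mp = X^-⋆-< (m * p) f n n<mp
    ... | no  n≮mp with ℕₚ.m+[n∸m]≡n (ℕₚ.≮⇒≥ n≮mp)
    ...   | mp+l≡n = ≡.subst (λ n → (X R.^ (m * p) R.* f) n A.≈ A.0#) mp+l≡n (A.trans (X^-⋆-+ (m * p) f (n ∸ m * p))
      (good (n ∸ m * p) (ℕₚ.≤-<-trans (ℕₚ.m∸n≤m n (m * p)) n<N) (drop-% m (n ∸ m * p) (≡.trans (≡.cong (_% p) mp+l≡n) n%p≡r))))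

    -- f equals (1 - X^(mp)) f + X^(mp) f, so its coefficient at n reduces to the one at n - mp, in
    -- the same residue class; m ≥ 1 makes this a descent.
    good-unshift : ∀ m {f} → 1 ≤ m → Good ((R.1# R.- X R.^ (m * p)) R.* f) → Good f
    good-unshift m {f} 1≤m good n = go (suc n) n ℕₚ.≤-refl
      where
      recover : f ≋ ((R.1# R.- X R.^ (m * p)) R.* f) R.+ X R.^ (m * p) R.* f
      recover = R.solve 2 (λ x f → f R.:= (R.con (+ 1) R.:- x) R.:* f R.:+ x R.:* f) R.refl (X R.^ (m * p)) f
      -- The bound b turns the descent in n into structural recursion.
      go : ∀ b n → n ℕ.< b → n ℕ.< N → n % p ≡ r → f n A.≈ A.0#
      go (suc b) n (s≤s n≤b) n<N n%p≡r = A.trans (at recover n n<N)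
        (A.trans (A.+-cong (good n n<N n%p≡r) shifted) (A.+-identityʳ A.0#))
        where
        shifted : (X R.^ (m * p) R.* f) n A.≈ A.0#
        shifted with n ℕₚ.<? m * p
        ... | yes n<mp = X^-⋆-< (m * p) f n n<mp
        ... | no  n≮mp with ℕₚ.m+[n∸m]≡n (ℕₚ.≮⇒≥ n≮mp)
        ...   | mp+l≡n = ≡.subst (λ n → (X R.^ (m * p) R.* f) n A.≈ A.0#) mp+l≡n (A.trans (X^-⋆-+ (m * p) f l)
          (go b l (ℕₚ.<-≤-trans l<n n≤b) (ℕₚ.<-trans l<n n<N) (drop-% m l (≡.trans (≡.cong (_% p) mp+l≡n) n%p≡r))))
          where
          l = n ∸ m * p
          l<n : l ℕ.< n
          l<n = ≡.subst (l ℕ.<_) mp+l≡n (ℕₚ.m<n+m l (ℕₚ.*-mono-≤ 1≤m (ℕ.>-nonZero⁻¹ p)))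

    vanishing : ResidueClasses.VanishingClass ring[[X]] X p r
    vanishing = record
      { Good     = Good
      ; resp     = λ f≋g good n n<N n%p≡r → A.trans (A.sym (at f≋g n n<N)) (good n n<N n%p≡r)
      ; 0-good   = λ _ _ _ → A.refl
      ; +-good   = λ good good′ n n<N n%p≡r → A.trans (A.+-cong (good n n<N n%p≡r) (good′ n n<N n%p≡r)) (A.+-identityʳ A.0#)
      ; neg-good = λ good n n<N n%p≡r → A.-‿cong (good n n<N n%p≡r)
      ; shift    = good-shift
      ; unshift  = good-unshift
      ; monomial = λ e e%p≢r n n<N n%p≡r → X^-coeff e n λ { ≡.refl → e%p≢r n%p≡r }
      }

theorem1p18 : (p : ℕ) → Prime p → 5 ≤ p →
    (r : ℕ) → 1 ≤ r → r ≤ p ∸ 1 →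
    (QNR (3 * r + 1) p ⊎ p ∣ (3 * r + 1)) →
    (n k j : ℕ) → j ≤ k →
    p ∣ a (p * (k ∸ j) + (p ∸ 3)) (p * k + (p + 2)) (p * n + r)
theorem1p18 p pPrime 5≤p r _ r≤p-1 cond n k j j≤k =
  ℤS.∣⇒∣ᵤ {+ p} {+ a c s e} (ℤS.divides (quotient coefficient≡0) (≡.trans (equality coefficient≡0) (ℤₚ.+-identityˡ _)))
  where
  open _≡_[mod_]
  instance
    p≢0 : NonZero p
    p≢0 = prime⇒nonZero pPrime
  c = p * (k ∸ j) + (p ∸ 3)
  -- The exponent s - c of f_2: the terms pk + p cancel and 2 + 3 remains beside pj.
  d = p * j + 5
  s = p * k + (p + 2)
  e = p * n + r
  -- The least truncation that still keeps the coefficient at e.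
  N = suc e
  open SeriesMod p N
  open PowerSeries (ℤ/ p) N using (ring[[X]]; X; X^N≋0)
  open GeneratingFunction.Parts ring[[X]] X N X^N≋0 W W-[] W-∷ using (generatingFunction; f₁-inverse)
  open RingTools ring[[X]] using (_≈_; _^_) renaming (_*_ to _·_)
  open ThetaQuotient ring[[X]] X N X^N≋0 using (f₁; f₂)

  c+d≡s : c + d ≡ s
  c+d≡s = ≡.trans (collect p (p ∸ 3) (k ∸ j) j)
    (≡.cong₂ (λ x y → p * x + (y + 2)) (ℕₚ.m∸n+n≡m j≤k) (ℕₚ.m∸n+n≡m (ℕₚ.≤-trans (s≤s (s≤s (s≤s z≤n))) 5≤p)))
    where
    collect : ∀ p t l j → p * l + t + (p * j + 5) ≡ p * (l + j) + (t + 3 + 2)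
    collect = solve-∀

  product≈ : f₁ ^ s · W (colouredParts c s e) ≈ f₂ ^ d
  product≈ = ≡.subst (λ s → f₁ ^ s · W (colouredParts c s e) ≈ f₂ ^ d) c+d≡s (generatingFunction c d e ≡.refl)

  e%p≡r : e % p ≡ r
  e%p≡r = ≡.trans (≡.cong (_% p) (≡.trans (ℕₚ.+-comm (p * n) r) (≡.cong (λ m → r + m) (ℕₚ.*-comm p n))))
    (≡.trans ([m+kn]%n≡m%n r n p) (m<n⇒m%n≡m (≡.subst (suc r ≤_) (ℕₚ.m+[n∸m]≡n (ℕₚ.≤-trans (s≤s z≤n) 5≤p)) (s≤s r≤p-1))))

  coefficient≡0 : + a c s e ≡ + 0 [mod p ]
  coefficient≡0 = ResidueClasses.Consequences.quotient-good ring[[X]] X p r N X^N≋0 (vanishing r) pPrime 5≤p p≈0 cond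
    k j f₁-inverse product≈ e ℕₚ.≤-refl e%p≡r
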